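{- For all integers $k>1$, \[ c_k=1+O\Bigl(\frac1k\Bigr) \] with an absolute implied constant, where \[ c_k := \frac{2k}{2k-1}\,\frac{\zeta(2-1/k)}{\zeta(2)}\,\zeta(k)^2\prod_{p}\Bigl(1-\frac{2p}{(p+1)p^{k}}\Bigr). \]
   Context: $\zeta$ is the Riemann zeta function and the product is over all primes $p$. -}

module Defs where

open import Data.Nat.Base as ℕ using (ℕ; zero; suc; NonZero; z≤n; s≤s)
import Data.Nat.Properties as ℕ
open import Data.Nat.Primality using (Prime; prime?; prime⇒nonZero)
import Data.Integer.Base as ℤ
import Data.Integer.Properties as ℤ
open import Data.Rational.Base
  using (ℚ; mkℚ; 0ℚ; 1ℚ; ½; _+_; _*_; _-_; -_; _/_; _≤_; _<_; ∣_∣; 1/_;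
         toℚᵘ; ↥_; ↧ₙ_; nonNegative; positive; ≢-nonZero)
import Data.Rational.Properties as ℚ
open import Data.Rational.Solver using (module +-*-Solver)
import Data.Rational.Unnormalised.Base as ℚᵘ
import Data.Rational.Unnormalised.Properties as ℚᵘ
open import Data.Product.Base using (∃-syntax; _×_; _,_; proj₁; proj₂)
open import Data.Sum.Base using (inj₁; inj₂)
open import Relation.Nullary.Decidable.Core using (Dec; yes; no)
open import Relation.Nullary.Negation.Core using (contradiction)
open import Relation.Binary.PropositionalEquality
  using (_≡_; refl; sym; trans; cong; cong₂; subst; subst₂; module ≡-Reasoning)

------------------------------------------------------------------------
-- Rational inequalities

infix 8 _⁄_

_⁄_ : (m n : ℕ) .{{_ : NonZero n}} → ℚ
m ⁄ n = ℤ.+ m / n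

⁄-≤ : ∀ a b c d .{{_ : NonZero b}} .{{_ : NonZero d}} →
      a ℕ.* d ℕ.≤ c ℕ.* b → a ⁄ b ≤ c ⁄ d
⁄-≤ a b@(suc b′) c d@(suc d′) ad≤cb = ℚ.toℚᵘ-cancel-≤ (begin
  toℚᵘ (a ⁄ b)              ≃⟨ ℚ.toℚᵘ-fromℚᵘ (ℚᵘ.mkℚᵘ (ℤ.+ a) b′) ⟩
  ℚᵘ.mkℚᵘ (ℤ.+ a) b′        ≤⟨ ℚᵘ.*≤* (subst₂ ℤ._≤_ (ℤ.pos-* a d) (ℤ.pos-* c b) (ℤ.+≤+ ad≤cb)) ⟩
  ℚᵘ.mkℚᵘ (ℤ.+ c) d′        ≃⟨ ℚᵘ.≃-sym (ℚ.toℚᵘ-fromℚᵘ (ℚᵘ.mkℚᵘ (ℤ.+ c) d′)) ⟩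
  toℚᵘ (c ⁄ d)              ∎)
  where open ℚᵘ.≤-Reasoning

⁄-≡ : ∀ a b c d .{{_ : NonZero b}} .{{_ : NonZero d}} →
      a ℕ.* d ≡ c ℕ.* b → a ⁄ b ≡ c ⁄ d
⁄-≡ a b c d eq = ℚ.≤-antisym (⁄-≤ a b c d (ℕ.≤-reflexive eq))
                             (⁄-≤ c d a b (ℕ.≤-reflexive (sym eq)))

⁄-* : ∀ a b c d .{{_ : NonZero b}} .{{_ : NonZero d}} .{{_ : NonZero (b ℕ.* d)}} →
      a ⁄ b * c ⁄ d ≡ (a ℕ.* c) ⁄ (b ℕ.* d)
⁄-* a b@(suc b′) c d@(suc d′) = ℚ.toℚᵘ-injective (begin
  toℚᵘ (a ⁄ b * c ⁄ d)              ≈⟨ ℚ.toℚᵘ-homo-* (a ⁄ b) (c ⁄ d) ⟩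
  toℚᵘ (a ⁄ b) ℚᵘ.* toℚᵘ (c ⁄ d)    ≈⟨ ℚᵘ.*-cong (ℚ.toℚᵘ-fromℚᵘ (ℚᵘ.mkℚᵘ (ℤ.+ a) b′)) (ℚ.toℚᵘ-fromℚᵘ (ℚᵘ.mkℚᵘ (ℤ.+ c) d′)) ⟩
  ℚᵘ.mkℚᵘ (ℤ.+ a ℤ.* ℤ.+ c) _       ≡⟨ cong (λ z → ℚᵘ.mkℚᵘ z _) (sym (ℤ.pos-* a c)) ⟩
  ℚᵘ.mkℚᵘ (ℤ.+ (a ℕ.* c)) _         ≈⟨ ℚ.toℚᵘ-fromℚᵘ (ℚᵘ.mkℚᵘ (ℤ.+ (a ℕ.* c)) _) ⟨
  toℚᵘ ((a ℕ.* c) ⁄ (b ℕ.* d))      ∎)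
  where open ℚᵘ.≃-Reasoning

⁄-+ : ∀ a b c .{{_ : NonZero b}} → a ⁄ b + c ⁄ b ≡ (a ℕ.+ c) ⁄ b
⁄-+ a b c = begin
  a ⁄ b + c ⁄ b                   ≡⟨ cong₂ _+_ (split a) (split c) ⟩
  a ⁄ 1 * 1 ⁄ b + c ⁄ 1 * 1 ⁄ b   ≡⟨ ℚ.*-distribʳ-+ (1 ⁄ b) (a ⁄ 1) (c ⁄ 1) ⟨
  (a ⁄ 1 + c ⁄ 1) * 1 ⁄ b         ≡⟨ cong (_* 1 ⁄ b) whole ⟩
  (a ℕ.+ c) ⁄ 1 * 1 ⁄ b           ≡⟨ split (a ℕ.+ c) ⟨
  (a ℕ.+ c) ⁄ b                   ∎
  where
  open ≡-Reasoning
  instance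
    1*b≢0 : NonZero (1 ℕ.* b)
    1*b≢0 = ℕ.m*n≢0 1 b
  split : ∀ x → x ⁄ b ≡ x ⁄ 1 * 1 ⁄ b
  split x = sym (trans (⁄-* x 1 1 b)
    (⁄-≡ (x ℕ.* 1) (1 ℕ.* b) x b
      (cong₂ ℕ._*_ (ℕ.*-identityʳ x) (sym (ℕ.*-identityˡ b)))))
  ⁄1 : ∀ x → toℚᵘ (x ⁄ 1) ℚᵘ.≃ ℚᵘ.mkℚᵘ (ℤ.+ x) 0
  ⁄1 x = ℚ.toℚᵘ-fromℚᵘ (ℚᵘ.mkℚᵘ (ℤ.+ x) 0)
  whole : a ⁄ 1 + c ⁄ 1 ≡ (a ℕ.+ c) ⁄ 1
  whole = ℚ.toℚᵘ-injective (ℚᵘ.≃-trans (ℚ.toℚᵘ-homo-+ (a ⁄ 1) (c ⁄ 1))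
    (ℚᵘ.≃-trans (ℚᵘ.+-cong (⁄1 a) (⁄1 c))
    (ℚᵘ.≃-trans (ℚᵘ.≃-reflexive (cong (λ z → ℚᵘ.mkℚᵘ z 0)
        (cong₂ ℤ._+_ (ℤ.*-identityʳ (ℤ.+ a)) (ℤ.*-identityʳ (ℤ.+ c)))))
      (ℚᵘ.≃-sym (⁄1 (a ℕ.+ c))))))

0≤⁄ : ∀ a b .{{_ : NonZero b}} → 0ℚ ≤ a ⁄ b
0≤⁄ a b = ⁄-≤ 0 1 a b z≤n

≤-by-- : ∀ a b {e} → a ≤ b + e → a - b ≤ e
≤-by-- a b {e} a≤b+e = ℚ.≤-trans (ℚ.+-monoˡ-≤ (- b) a≤b+e)
  (ℚ.≤-reflexive (solve 2 (λ b e → (b :+ e) :- b := e) refl b e))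
  where open +-*-Solver

p≤∣p∣ : ∀ p → p ≤ ∣ p ∣
p≤∣p∣ p with ℚ.≤-total 0ℚ p
... | inj₁ 0≤p = ℚ.≤-reflexive (sym (ℚ.0≤p⇒∣p∣≡p 0≤p))
... | inj₂ p≤0 = ℚ.≤-trans p≤0 (ℚ.0≤∣p∣ p)

∣-∣≤ : ∀ a b {e} → a ≤ b + e → b ≤ a + e → ∣ a - b ∣ ≤ e
∣-∣≤ a b {e} a≤ b≤ with ℚ.∣p∣≡p∨∣p∣≡-p (a - b)
... | inj₁ eq = ℚ.≤-trans (ℚ.≤-reflexive eq) (≤-by-- a b a≤)
... | inj₂ eq = ℚ.≤-trans (ℚ.≤-reflexive (trans eq flip)) (≤-by-- b a b≤)
  where
  open +-*-Solver
  flip : - (a - b) ≡ b - a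
  flip = solve 2 (λ a b → :- (a :- b) := b :- a) refl a b

∣-∣-comm : ∀ a b → ∣ a - b ∣ ≡ ∣ b - a ∣
∣-∣-comm a b = trans (sym (ℚ.∣-p∣≡∣p∣ (a - b)))
  (cong ∣_∣ (solve 2 (λ a b → :- (a :- b) := b :- a) refl a b))
  where open +-*-Solver

∣-∣-triangle : ∀ a b c {e f} → ∣ a - b ∣ ≤ e → ∣ b - c ∣ ≤ f → ∣ a - c ∣ ≤ e + f
∣-∣-triangle a b c p q = ℚ.≤-trans
  (subst (λ z → ∣ z ∣ ≤ ∣ a - b ∣ + ∣ b - c ∣)
    (solve 3 (λ a b c → (a :- b) :+ (b :- c) := a :- c) refl a b c)
    (ℚ.∣p+q∣≤∣p∣+∣q∣ (a - b) (b - c)))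
  (ℚ.+-mono-≤ p q)
  where open +-*-Solver

*-mono-≤ : ∀ {a b c d} → 0ℚ ≤ a → a ≤ b → 0ℚ ≤ c → c ≤ d → a * c ≤ b * d
*-mono-≤ {a} {b} {c} {d} 0≤a a≤b 0≤c c≤d = ℚ.≤-trans
  (ℚ.*-monoʳ-≤-nonNeg c {{nonNegative 0≤c}} a≤b)
  (ℚ.*-monoˡ-≤-nonNeg b {{nonNegative (ℚ.≤-trans 0≤a a≤b)}} c≤d)

0≤* : ∀ {a b} → 0ℚ ≤ a → 0ℚ ≤ b → 0ℚ ≤ a * b
0≤* 0≤a 0≤b = *-mono-≤ ℚ.≤-refl 0≤a ℚ.≤-refl 0≤b

0<* : ∀ {a b} → 0ℚ < a → 0ℚ < b → 0ℚ < a * b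
0<* {a} {b} 0<a 0<b = ℚ.positive⁻¹ (a * b)
  {{ℚ.pos*pos⇒pos a {{positive 0<a}} b {{positive 0<b}}}}

0<½* : ∀ {e} → 0ℚ < e → 0ℚ < ½ * e
0<½* = 0<* (ℚ.positive⁻¹ ½)

½*+½* : ∀ e → ½ * e + ½ * e ≡ e
½*+½* e = trans (sym (ℚ.*-distribʳ-+ e ½ ½)) (ℚ.*-identityˡ e)

archimedean : ∀ {e} → 0ℚ < e → ∃[ K ] 1 ⁄ suc K ≤ e
archimedean {e@(mkℚ (ℤ.+ zero) d c)} 0<e = contradiction (positive 0<e) λ ()
archimedean {e@(mkℚ (ℤ.-[1+ n ]) d c)} 0<e = contradiction (positive 0<e) λ ()
archimedean {e@(mkℚ (ℤ.+[1+ n ]) d c)} 0<e = d ,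
  ℚ.≤-trans (⁄-≤ 1 (suc d) (suc n) (suc d) (ℕ.*-monoˡ-≤ (suc d) (s≤s (z≤n {n}))))
            (ℚ.≤-reflexive (ℚ.↥p/↧p≡p e))

------------------------------------------------------------------------
-- Real numbers

-- Real numbers are Cauchy sequences of rationals carrying a modulus, with no
-- quotient: the order below is the one induced on limits.
record ℝ : Set where
  constructor mkℝ
  field
    seq    : ℕ → ℚ
    cauchy : ∀ ε → 0ℚ < ε → ∃[ N ] (∀ m n → N ℕ.≤ m → N ℕ.≤ n → ∣ seq m - seq n ∣ ≤ ε)

open ℝ public

fromℚ : ℚ → ℝ
fromℚ q = mkℝ (λ _ → q) λ ε 0<ε → 0 , λ _ _ _ _ →
  subst (λ z → ∣ z ∣ ≤ ε) (sym (ℚ.+-inverseʳ q)) (ℚ.<⇒≤ 0<ε)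

infix 4 _≤ᴿ_ _<ᴿ_

_≤ᴿ_ : ℝ → ℝ → Set
x ≤ᴿ y = ∀ ε → 0ℚ < ε → ∃[ N ] (∀ n → N ℕ.≤ n → seq x n ≤ seq y n + ε)

_<ᴿ_ : ℝ → ℝ → Set
x <ᴿ y = ∃[ δ ] 0ℚ < δ × ∃[ N ] (∀ n → N ℕ.≤ n → seq x n + δ ≤ seq y n)

infixl 6 _+ᴿ_ _-ᴿ_
infixl 7 _*ᴿ_
infix  8 -ᴿ_

_+ᴿ_ : ℝ → ℝ → ℝ
x +ᴿ y = mkℝ (λ n → seq x n + seq y n) λ ε 0<ε →
  let Nx , cx = cauchy x (½ * ε) (0<½* 0<ε)
      Ny , cy = cauchy y (½ * ε) (0<½* 0<ε)
  in Nx ℕ.⊔ Ny , λ m n N≤m N≤n → begin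
    ∣ (seq x m + seq y m) - (seq x n + seq y n) ∣
      ≡⟨ cong ∣_∣ (solve 4 (λ a b c d → (a :+ b) :- (c :+ d) := (a :- c) :+ (b :- d)) refl
                  (seq x m) (seq y m) (seq x n) (seq y n)) ⟩
    ∣ (seq x m - seq x n) + (seq y m - seq y n) ∣
      ≤⟨ ℚ.∣p+q∣≤∣p∣+∣q∣ (seq x m - seq x n) (seq y m - seq y n) ⟩
    ∣ seq x m - seq x n ∣ + ∣ seq y m - seq y n ∣
      ≤⟨ ℚ.+-mono-≤ (cx m n (ℕ.m⊔n≤o⇒m≤o Nx Ny N≤m) (ℕ.m⊔n≤o⇒m≤o Nx Ny N≤n))
                    (cy m n (ℕ.m⊔n≤o⇒n≤o Nx Ny N≤m) (ℕ.m⊔n≤o⇒n≤o Nx Ny N≤n)) ⟩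
    ½ * ε + ½ * ε ≡⟨ ½*+½* ε ⟩
    ε ∎
  where
  open ℚ.≤-Reasoning
  open +-*-Solver

-ᴿ_ : ℝ → ℝ
-ᴿ x = mkℝ (λ n → - seq x n) λ ε 0<ε →
  let N , c = cauchy x ε 0<ε
  in N , λ m n N≤m N≤n → subst (_≤ ε)
    (trans (∣-∣-comm (seq x m) (seq x n)) (cong ∣_∣
      (solve 2 (λ a b → b :- a := :- a :- (:- b)) refl (seq x m) (seq x n))))
    (c m n N≤m N≤n)
  where open +-*-Solver

_-ᴿ_ : ℝ → ℝ → ℝ
x -ᴿ y = x +ᴿ -ᴿ y

∣_∣ᴿ : ℝ → ℝ
∣ x ∣ᴿ = mkℝ (λ n → ∣ seq x n ∣) λ ε 0<ε →
  let N , c = cauchy x ε 0<ε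
      half : ∀ m n → N ℕ.≤ m → N ℕ.≤ n → ∣ seq x m ∣ ≤ ∣ seq x n ∣ + ε
      half m n N≤m N≤n = begin
        ∣ seq x m ∣
          ≡⟨ cong ∣_∣ (solve 2 (λ a b → a := b :+ (a :- b)) refl (seq x m) (seq x n)) ⟩
        ∣ seq x n + (seq x m - seq x n) ∣
          ≤⟨ ℚ.∣p+q∣≤∣p∣+∣q∣ (seq x n) (seq x m - seq x n) ⟩
        ∣ seq x n ∣ + ∣ seq x m - seq x n ∣
          ≤⟨ ℚ.+-monoʳ-≤ ∣ seq x n ∣ (c m n N≤m N≤n) ⟩
        ∣ seq x n ∣ + ε ∎
  in N , λ m n N≤m N≤n → ∣-∣≤ ∣ seq x m ∣ ∣ seq x n ∣ (half m n N≤m N≤n) (half n m N≤n N≤m)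
  where
  open ℚ.≤-Reasoning
  open +-*-Solver

eventually-bounded : ∀ x → ∃[ B ] 0ℚ < B × ∃[ N ] (∀ n → N ℕ.≤ n → ∣ seq x n ∣ ≤ B)
eventually-bounded x = ∣ seq x N ∣ + 1ℚ ,
  ℚ.+-mono-≤-< (ℚ.0≤∣p∣ (seq x N)) (ℚ.positive⁻¹ 1ℚ) , N , λ n N≤n → begin
    ∣ seq x n ∣
      ≡⟨ cong ∣_∣ (solve 2 (λ a b → a := b :+ (a :- b)) refl (seq x n) (seq x N)) ⟩
    ∣ seq x N + (seq x n - seq x N) ∣
      ≤⟨ ℚ.∣p+q∣≤∣p∣+∣q∣ (seq x N) (seq x n - seq x N) ⟩
    ∣ seq x N ∣ + ∣ seq x n - seq x N ∣
      ≤⟨ ℚ.+-monoʳ-≤ ∣ seq x N ∣ (c n N N≤n ℕ.≤-refl) ⟩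
    ∣ seq x N ∣ + 1ℚ ∎
  where
  open ℚ.≤-Reasoning
  open +-*-Solver
  N = proj₁ (cauchy x 1ℚ (ℚ.positive⁻¹ 1ℚ))
  c = proj₂ (cauchy x 1ℚ (ℚ.positive⁻¹ 1ℚ))

_*ᴿ_ : ℝ → ℝ → ℝ
x *ᴿ y = mkℝ (λ n → seq x n * seq y n) λ ε 0<ε →
  let Bx , 0<Bx , Mx , bx = eventually-bounded x
      By , 0<By , My , by = eventually-bounded y
      B     = Bx + By
      0<B : 0ℚ < B
      0<B   = ℚ.+-mono-< 0<Bx 0<By
      instance B≢0 = ℚ.pos⇒nonZero B {{positive 0<B}}
      δ     = 1/ B * ε
      0<δ   = 0<* (ℚ.positive⁻¹ (1/ B) {{ℚ.1/pos⇒pos B {{positive 0<B}}}}) 0<ε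
      Nx , cx = cauchy x δ 0<δ
      Ny , cy = cauchy y δ 0<δ
      M = Mx ℕ.⊔ My
      N = Nx ℕ.⊔ Ny
  in M ℕ.⊔ N , λ m n K≤m K≤n →
  let M≤m = ℕ.m⊔n≤o⇒m≤o M N K≤m
      M≤n = ℕ.m⊔n≤o⇒m≤o M N K≤n
      N≤m = ℕ.m⊔n≤o⇒n≤o M N K≤m
      N≤n = ℕ.m⊔n≤o⇒n≤o M N K≤n
      a = seq x m ; b = seq y m ; c = seq x n ; d = seq y n
  in begin
    ∣ a * b - c * d ∣
      ≡⟨ cong ∣_∣ (solve 4 (λ a b c d → a :* b :- c :* d := a :* (b :- d) :+ d :* (a :- c))
                  refl a b c d) ⟩
    ∣ a * (b - d) + d * (a - c) ∣
      ≤⟨ ℚ.∣p+q∣≤∣p∣+∣q∣ (a * (b - d)) (d * (a - c)) ⟩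
    ∣ a * (b - d) ∣ + ∣ d * (a - c) ∣
      ≡⟨ cong₂ _+_ (ℚ.∣p*q∣≡∣p∣*∣q∣ a (b - d)) (ℚ.∣p*q∣≡∣p∣*∣q∣ d (a - c)) ⟩
    ∣ a ∣ * ∣ b - d ∣ + ∣ d ∣ * ∣ a - c ∣
      ≤⟨ ℚ.+-mono-≤
           (*-mono-≤ (ℚ.0≤∣p∣ a) (bx m (ℕ.m⊔n≤o⇒m≤o Mx My M≤m))
                     (ℚ.0≤∣p∣ (b - d)) (cy m n (ℕ.m⊔n≤o⇒n≤o Nx Ny N≤m) (ℕ.m⊔n≤o⇒n≤o Nx Ny N≤n)))
           (*-mono-≤ (ℚ.0≤∣p∣ d) (by n (ℕ.m⊔n≤o⇒n≤o Mx My M≤n))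
                     (ℚ.0≤∣p∣ (a - c)) (cx m n (ℕ.m⊔n≤o⇒m≤o Nx Ny N≤m) (ℕ.m⊔n≤o⇒m≤o Nx Ny N≤n))) ⟩
    Bx * δ + By * δ
      ≡⟨ ℚ.*-distribʳ-+ δ Bx By ⟨
    B * (1/ B * ε)
      ≡⟨ ℚ.*-assoc B (1/ B) ε ⟨
    B * 1/ B * ε
      ≡⟨ cong (_* ε) (ℚ.*-inverseʳ B) ⟩
    1ℚ * ε
      ≡⟨ ℚ.*-identityˡ ε ⟩
    ε ∎
  where
  open ℚ.≤-Reasoning
  open +-*-Solver

-- Total reciprocal on ℚ, with the value 0 at 0.
inv : ℚ → ℚ
inv q with q ℚ.≟ 0ℚ
... | yes _  = 0ℚ
... | no q≢0 = (1/ q) {{≢-nonZero q≢0}}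

inv-inverseʳ : ∀ {q} → 0ℚ < q → q * inv q ≡ 1ℚ
inv-inverseʳ {q} 0<q with q ℚ.≟ 0ℚ
... | yes q≡0 = contradiction (sym q≡0) (ℚ.<⇒≢ 0<q)
... | no q≢0  = ℚ.*-inverseʳ q {{≢-nonZero q≢0}}

0≤inv : ∀ {q} → 0ℚ < q → 0ℚ ≤ inv q
0≤inv {q} 0<q = ℚ.*-cancelˡ-≤-pos q {{positive 0<q}}
  (subst₂ _≤_ (sym (ℚ.*-zeroʳ q)) (sym (inv-inverseʳ 0<q)) (ℚ.nonNegative⁻¹ 1ℚ))

-- The reciprocal of a positive real number.
recip : (x : ℝ) → fromℚ 0ℚ <ᴿ x → ℝ
recip x (δ , 0<δ , M , δ≤) = mkℝ (λ n → inv (seq x n)) λ ε 0<ε →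
  let N , c = cauchy x (ε * (δ * δ)) (0<* 0<ε (0<* 0<δ 0<δ))
  in M ℕ.⊔ N , λ m n K≤m K≤n →
  let a = seq x m ; b = seq x n
      M≤m = ℕ.m⊔n≤o⇒m≤o M N K≤m
      M≤n = ℕ.m⊔n≤o⇒m≤o M N K≤n
      0<a = 0<seq m M≤m
      0<b = 0<seq n M≤n
      i = inv a ; j = inv b
      0≤ij = 0≤* (0≤inv 0<a) (0≤inv 0<b)
  in begin
    ∣ i - j ∣
      ≡⟨ cong ∣_∣ (cong₂ _-_ (sym (ℚ.*-identityʳ i)) (sym (ℚ.*-identityʳ j))) ⟩
    ∣ i * 1ℚ - j * 1ℚ ∣
      ≡⟨ cong ∣_∣ (cong₂ (λ u v → i * u - j * v) (sym (inv-inverseʳ 0<b)) (sym (inv-inverseʳ 0<a))) ⟩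
    ∣ i * (b * j) - j * (a * i) ∣
      ≡⟨ cong ∣_∣ (solve 4 (λ a b i j → i :* (b :* j) :- j :* (a :* i) := (b :- a) :* (i :* j))
                  refl a b i j) ⟩
    ∣ (b - a) * (i * j) ∣
      ≡⟨ ℚ.∣p*q∣≡∣p∣*∣q∣ (b - a) (i * j) ⟩
    ∣ b - a ∣ * ∣ i * j ∣
      ≡⟨ cong (∣ b - a ∣ *_) (ℚ.0≤p⇒∣p∣≡p 0≤ij) ⟩
    ∣ b - a ∣ * (i * j)
      ≤⟨ ℚ.*-monoʳ-≤-nonNeg (i * j) {{nonNegative 0≤ij}}
           (c n m (ℕ.m⊔n≤o⇒n≤o M N K≤n) (ℕ.m⊔n≤o⇒n≤o M N K≤m)) ⟩
    ε * (δ * δ) * (i * j)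
      ≡⟨ solve 4 (λ e d i j → e :* (d :* d) :* (i :* j) := e :* ((d :* i) :* (d :* j)))
           refl ε δ i j ⟩
    ε * ((δ * i) * (δ * j))
      ≤⟨ ℚ.*-monoˡ-≤-nonNeg ε {{nonNegative (ℚ.<⇒≤ 0<ε)}}
           (*-mono-≤ (0≤* (ℚ.<⇒≤ 0<δ) (0≤inv 0<a)) (δ*inv≤1 m M≤m)
                     (0≤* (ℚ.<⇒≤ 0<δ) (0≤inv 0<b)) (δ*inv≤1 n M≤n)) ⟩
    ε * (1ℚ * 1ℚ)
      ≡⟨ ℚ.*-identityʳ ε ⟩
    ε ∎
  where
  open ℚ.≤-Reasoning
  open +-*-Solver
  δ≤seq : ∀ n → M ℕ.≤ n → δ ≤ seq x n
  δ≤seq n M≤n = subst (_≤ seq x n) (ℚ.+-identityˡ δ) (δ≤ n M≤n)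
  0<seq : ∀ n → M ℕ.≤ n → 0ℚ < seq x n
  0<seq n M≤n = ℚ.<-≤-trans 0<δ (δ≤seq n M≤n)
  δ*inv≤1 : ∀ n → M ℕ.≤ n → δ * inv (seq x n) ≤ 1ℚ
  δ*inv≤1 n M≤n = subst (δ * inv (seq x n) ≤_) (inv-inverseʳ (0<seq n M≤n))
    (ℚ.*-monoʳ-≤-nonNeg (inv (seq x n)) {{nonNegative (0≤inv (0<seq n M≤n))}} (δ≤seq n M≤n))

Cauchyᴿ : (ℕ → ℝ) → Set
Cauchyᴿ x = ∀ ε → 0ℚ < ε →
  ∃[ N ] (∀ m n → N ℕ.≤ m → N ℕ.≤ n → ∣ x m -ᴿ x n ∣ᴿ ≤ᴿ fromℚ ε)

-- The diagonal argument: the n-th approximant of the limit is within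
-- 1/(n+1) of x n.
lim : (x : ℕ → ℝ) → Cauchyᴿ x → ℝ
lim x cx = mkℝ (λ n → seq (x n) (I n)) λ ε 0<ε →
  let η = ½ * (½ * ε)
      0<η = 0<½* (0<½* 0<ε)
      K , 1/K≤η = archimedean 0<η
      N , c = cx η 0<η
      near : ∀ n j → K ℕ.≤ n → I n ℕ.≤ j → ∣ seq (x n) (I n) - seq (x n) j ∣ ≤ η
      near n j K≤n I≤j = ℚ.≤-trans (I-spec n (I n) j ℕ.≤-refl I≤j)
        (ℚ.≤-trans (⁄-≤ 1 (suc n) 1 (suc K) (ℕ.*-monoʳ-≤ 1 (s≤s K≤n))) 1/K≤η)
  in K ℕ.⊔ N , λ m n L≤m L≤n →
  let K≤m = ℕ.m⊔n≤o⇒m≤o K N L≤m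
      K≤n = ℕ.m⊔n≤o⇒m≤o K N L≤n
      J , d = c m n (ℕ.m⊔n≤o⇒n≤o K N L≤m) (ℕ.m⊔n≤o⇒n≤o K N L≤n) η 0<η
      j = J ℕ.⊔ (I m ℕ.⊔ I n)
      Im≤j = ℕ.≤-trans (ℕ.m≤m⊔n (I m) (I n)) (ℕ.m≤n⊔m J _)
      In≤j = ℕ.≤-trans (ℕ.m≤n⊔m (I m) (I n)) (ℕ.m≤n⊔m J _)
      a = seq (x m) (I m) ; b = seq (x m) j ; b′ = seq (x n) j ; a′ = seq (x n) (I n)
  in ℚ.≤-trans
    (∣-∣-triangle a b a′ (near m j K≤m Im≤j)
      (∣-∣-triangle b b′ a′ (d j (ℕ.m≤m⊔n J _))
        (subst (_≤ η) (∣-∣-comm a′ b′) (near n j K≤n In≤j))))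
    (ℚ.≤-reflexive (trans
      (solve 1 (λ h → h :+ ((h :+ h) :+ h) := (h :+ h) :+ (h :+ h)) refl η)
      (trans (cong₂ _+_ (½*+½* (½ * ε)) (½*+½* (½ * ε))) (½*+½* ε))))
  where
  open +-*-Solver
  0<1/ : ∀ n → 0ℚ < 1 ⁄ suc n
  0<1/ n = ℚ.positive⁻¹ (1 ⁄ suc n) {{ℚ.normalize-pos 1 (suc n)}}
  I : ℕ → ℕ
  I n = proj₁ (cauchy (x n) (1 ⁄ suc n) (0<1/ n))
  I-spec : ∀ n i j → I n ℕ.≤ i → I n ℕ.≤ j → ∣ seq (x n) i - seq (x n) j ∣ ≤ 1 ⁄ suc n
  I-spec n = proj₂ (cauchy (x n) (1 ⁄ suc n) (0<1/ n))

------------------------------------------------------------------------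
-- Powers n ^ (- a / b)

module Largest (P : ℕ → Set) (P? : ∀ r → Dec (P r)) where

  largest≤ : ℕ → ℕ
  largest≤ zero    = zero
  largest≤ (suc m) with P? (suc m)
  ... | yes _ = suc m
  ... | no  _ = largest≤ m

  largest≤-holds : P 0 → ∀ m → P (largest≤ m)
  largest≤-holds P0 zero    = P0
  largest≤-holds P0 (suc m) with P? (suc m)
  ... | yes p = p
  ... | no  _ = largest≤-holds P0 m

  largest≤-bounded : ∀ m → largest≤ m ℕ.≤ m
  largest≤-bounded zero    = z≤n
  largest≤-bounded (suc m) with P? (suc m)
  ... | yes _ = ℕ.≤-refl
  ... | no  _ = ℕ.m≤n⇒m≤1+n (largest≤-bounded m)

  largest≤-bound : ∀ m r → r ℕ.≤ m → P r → r ℕ.≤ largest≤ m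
  largest≤-bound zero    r r≤m p = r≤m
  largest≤-bound (suc m) r r≤m p with P? (suc m)
  ... | yes _ = r≤m
  ... | no ¬p with ℕ.m≤n⇒m<n∨m≡n r≤m
  ...   | inj₁ (s≤s r≤) = largest≤-bound m r r≤ p
  ...   | inj₂ refl     = contradiction p ¬p

n≤2^n : ∀ n → n ℕ.≤ 2 ℕ.^ n
n≤2^n zero    = z≤n
n≤2^n (suc n) = ℕ.+-mono-≤ (ℕ.m^n>0 2 n)
  (ℕ.≤-trans (n≤2^n n) (ℕ.≤-reflexive (sym (ℕ.+-identityʳ (2 ℕ.^ n)))))

^-cancelˡ-≤ : ∀ b .{{_ : NonZero b}} {m n} → m ℕ.^ b ℕ.≤ n ℕ.^ b → m ℕ.≤ n
^-cancelˡ-≤ b {m} {n} le with m ℕ.≤? n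
... | yes m≤n = m≤n
... | no  m≰n = contradiction le (ℕ.<⇒≱ (ℕ.^-monoˡ-< b (ℕ.≰⇒> m≰n)))

^-distribʳ-* : ∀ b m n → (m ℕ.* n) ℕ.^ b ≡ m ℕ.^ b ℕ.* n ℕ.^ b
^-distribʳ-* zero    m n = refl
^-distribʳ-* (suc b) m n = trans (cong (m ℕ.* n ℕ.*_) (^-distribʳ-* b m n))
  (ℕ.[m*n]*[o*p]≡[m*o]*[n*p] m n (m ℕ.^ b) (n ℕ.^ b))

module _ (n a b : ℕ) .{{_ : NonZero n}} .{{_ : NonZero b}} where

  -- r / M ≤ n ^ (- a / b), with roots and denominators cleared.
  Below : ℕ → ℕ → Set
  Below M r = r ℕ.^ b ℕ.* n ℕ.^ a ℕ.≤ M ℕ.^ b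

  open module L (M : ℕ) = Largest (Below M) (λ r → r ℕ.^ b ℕ.* n ℕ.^ a ℕ.≤? M ℕ.^ b)

  -- ⌊ M n ^ (- a / b) ⌋.  Searching up to M suffices because n ^ (- a / b) ≤ 1.
  floorPow : ℕ → ℕ
  floorPow M = largest≤ M M

  floor-lower : ∀ M → Below M (floorPow M)
  floor-lower M = largest≤-holds M (0^b≤ b) M
    where
    0^b≤ : ∀ b .{{_ : NonZero b}} → 0 ℕ.^ b ℕ.* n ℕ.^ a ℕ.≤ M ℕ.^ b
    0^b≤ (suc b) = z≤n

  floor-upper : ∀ M → M ℕ.^ b ℕ.≤ suc (floorPow M) ℕ.^ b ℕ.* n ℕ.^ a
  floor-upper M with M ℕ.^ b ℕ.≤? suc (floorPow M) ℕ.^ b ℕ.* n ℕ.^ a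
  ... | yes le = le
  ... | no ¬le = contradiction
    (largest≤-bound M M (suc (floorPow M))
      (^-cancelˡ-≤ b (ℕ.≤-trans (ℕ.m≤m*n _ (n ℕ.^ a) {{ℕ.m^n≢0 n a}}) (ℕ.<⇒≤ (ℕ.≰⇒> ¬le))))
      (ℕ.<⇒≤ (ℕ.≰⇒> ¬le)))
    (ℕ.<⇒≱ (ℕ.n<1+n _))

  floor-cross : ∀ M M′ → floorPow M ℕ.* M′ ℕ.≤ suc (floorPow M′) ℕ.* M
  floor-cross M M′ = ^-cancelˡ-≤ b
    (ℕ.*-cancelʳ-≤ _ _ (n ℕ.^ a) {{ℕ.m^n≢0 n a}} (begin
      (r ℕ.* M′) ℕ.^ b ℕ.* n ℕ.^ a            ≡⟨ cong (ℕ._* n ℕ.^ a) (^-distribʳ-* b r M′) ⟩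
      r ℕ.^ b ℕ.* M′ ℕ.^ b ℕ.* n ℕ.^ a        ≡⟨ xy·z (r ℕ.^ b) (M′ ℕ.^ b) (n ℕ.^ a) ⟩
      r ℕ.^ b ℕ.* n ℕ.^ a ℕ.* M′ ℕ.^ b        ≤⟨ ℕ.*-mono-≤ (floor-lower M) (floor-upper M′) ⟩
      M ℕ.^ b ℕ.* (s ℕ.^ b ℕ.* n ℕ.^ a)       ≡⟨ ℕ.*-comm (M ℕ.^ b) _ ⟩
      s ℕ.^ b ℕ.* n ℕ.^ a ℕ.* M ℕ.^ b         ≡⟨ xy·z (s ℕ.^ b) (n ℕ.^ a) (M ℕ.^ b) ⟩
      s ℕ.^ b ℕ.* M ℕ.^ b ℕ.* n ℕ.^ a         ≡⟨ cong (ℕ._* n ℕ.^ a) (^-distribʳ-* b s M) ⟨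
      (s ℕ.* M) ℕ.^ b ℕ.* n ℕ.^ a             ∎))
    where
    open ℕ.≤-Reasoning
    r = floorPow M
    s = suc (floorPow M′)
    xy·z : ∀ x y z → x ℕ.* y ℕ.* z ≡ x ℕ.* z ℕ.* y
    xy·z x y z = trans (ℕ.*-assoc x y z) (trans (cong (x ℕ.*_) (ℕ.*-comm y z)) (sym (ℕ.*-assoc x z y)))

  -- n ^ (- a / b): by floor-lower and floor-upper the j-th approximant is the
  -- largest multiple of 1 / (j + 1) not exceeding it.
  pow⁻ : ℝ
  pow⁻ = mkℝ (λ j → A j ⁄ suc j) λ ε 0<ε →
    let K , 1/K≤ε = archimedean 0<ε
        half : ∀ i j → K ℕ.≤ j → A i ⁄ suc i ≤ A j ⁄ suc j + ε
        half i j K≤j = begin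
          A i ⁄ suc i               ≤⟨ ⁄-≤ (A i) (suc i) (suc (A j)) (suc j) (floor-cross (suc i) (suc j)) ⟩
          suc (A j) ⁄ suc j         ≡⟨ cong (_⁄ suc j) (ℕ.+-comm 1 (A j)) ⟩
          (A j ℕ.+ 1) ⁄ suc j       ≡⟨ ⁄-+ (A j) (suc j) 1 ⟨
          A j ⁄ suc j + 1 ⁄ suc j   ≤⟨ ℚ.+-monoʳ-≤ (A j ⁄ suc j) (ℚ.≤-trans (⁄-≤ 1 (suc j) 1 (suc K) (ℕ.*-monoʳ-≤ 1 (s≤s K≤j))) 1/K≤ε) ⟩
          A j ⁄ suc j + ε           ∎
    in K , λ i j K≤i K≤j → ∣-∣≤ (A i ⁄ suc i) (A j ⁄ suc j) (half i j K≤j) (half j i K≤i)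
    where
    open ℚ.≤-Reasoning
    A : ℕ → ℕ
    A j = floorPow (suc j)

floorPow-1 : ∀ a b .{{_ : NonZero b}} M → floorPow 1 a b (suc M) ≡ suc M
floorPow-1 a b M = ℕ.≤-antisym (L.largest≤-bounded 1 a b (suc M) (suc M))
  (L.largest≤-bound 1 a b (suc M) (suc M) (suc M) ℕ.≤-refl
    (ℕ.≤-reflexive (trans (cong (suc M ℕ.^ b ℕ.*_) (ℕ.^-zeroˡ a)) (ℕ.*-identityʳ _))))

-- n ≥ 2 ^ (b J) and a / b ≥ 1 + 1 / b give n ^ (- a / b) ≤ 2 ^ (- (b + 1) J).
floorPow-decay : ∀ n a b M J .{{_ : NonZero n}} .{{_ : NonZero b}} → suc b ℕ.≤ a →
  2 ℕ.^ (b ℕ.* J) ℕ.≤ n → floorPow n a b M ℕ.* 2 ℕ.^ (suc b ℕ.* J) ℕ.≤ M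
floorPow-decay n a b M J b<a big = ^-cancelˡ-≤ b (begin
  (r ℕ.* 2 ℕ.^ (suc b ℕ.* J)) ℕ.^ b            ≡⟨ ^-distribʳ-* b r _ ⟩
  r ℕ.^ b ℕ.* (2 ℕ.^ (suc b ℕ.* J)) ℕ.^ b      ≡⟨ cong (r ℕ.^ b ℕ.*_) swap ⟩
  r ℕ.^ b ℕ.* (2 ℕ.^ (b ℕ.* J)) ℕ.^ suc b      ≤⟨ ℕ.*-monoʳ-≤ (r ℕ.^ b) (ℕ.^-monoˡ-≤ (suc b) big) ⟩
  r ℕ.^ b ℕ.* n ℕ.^ suc b                      ≤⟨ ℕ.*-monoʳ-≤ (r ℕ.^ b) (ℕ.^-monoʳ-≤ n b<a) ⟩
  r ℕ.^ b ℕ.* n ℕ.^ a                          ≤⟨ floor-lower n a b M ⟩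
  M ℕ.^ b                                      ∎)
  where
  open ℕ.≤-Reasoning
  r = floorPow n a b M
  swap : (2 ℕ.^ (suc b ℕ.* J)) ℕ.^ b ≡ (2 ℕ.^ (b ℕ.* J)) ℕ.^ suc b
  swap = trans (ℕ.^-*-assoc 2 (suc b ℕ.* J) b)
    (trans (cong (2 ℕ.^_) (trans (ℕ.*-assoc (suc b) J b)
      (trans (cong (suc b ℕ.*_) (ℕ.*-comm J b)) (ℕ.*-comm (suc b) (b ℕ.* J)))))
      (sym (ℕ.^-*-assoc 2 (b ℕ.* J) (suc b))))

------------------------------------------------------------------------
-- The zeta function at rational arguments s > 1

partialSum : (ℕ → ℝ) → ℕ → ℝ
partialSum x zero    = fromℚ 0ℚ
partialSum x (suc n) = partialSum x n +ᴿ x n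

-- (i + 1) ^ (- s), for s ≥ 0: there ∣ ↥ s ∣ is the numerator of s.
ζ-term : ℚ → ℕ → ℝ
ζ-term s i = pow⁻ (suc i) ℤ.∣ ↥ s ∣ (↧ₙ s)

-- Tail bound for a nonnegative series q with partial sums T, by blocks
-- 2 ^ (b J) ≤ i < 2 ^ (b (J + 1)); the J-th one contributes at most 2 ^ (b - J).
module BlockTail
  (b : ℕ) .{{b≢0 : NonZero b}} (T q : ℕ → ℚ)
  (T-suc : ∀ n → T (suc n) ≡ T n + q n)
  (0≤q : ∀ i → 0ℚ ≤ q i)
  (decay : ∀ J i → 2 ℕ.^ (b ℕ.* J) ℕ.≤ i → q i ≤ (1 ⁄ (2 ℕ.^ (suc b ℕ.* J))) {{ℕ.m^n≢0 2 (suc b ℕ.* J)}})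
  where

  T-mono : ∀ {m n} → m ℕ.≤ n → T m ≤ T n
  T-mono {m} {n} m≤n with ℕ.m≤n⇒∃[o]m+o≡n m≤n
  ... | d , refl = go d
    where
    open ℚ.≤-Reasoning
    go : ∀ d → T m ≤ T (m ℕ.+ d)
    go zero    = ℚ.≤-reflexive (cong T (sym (ℕ.+-identityʳ m)))
    go (suc d) = begin
      T m                        ≤⟨ go d ⟩
      T (m ℕ.+ d)                ≡⟨ ℚ.+-identityʳ (T (m ℕ.+ d)) ⟨
      T (m ℕ.+ d) + 0ℚ           ≤⟨ ℚ.+-monoʳ-≤ (T (m ℕ.+ d)) (0≤q (m ℕ.+ d)) ⟩
      T (m ℕ.+ d) + q (m ℕ.+ d)  ≡⟨ T-suc (m ℕ.+ d) ⟨
      T (suc (m ℕ.+ d))          ≡⟨ cong T (ℕ.+-suc m d) ⟨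
      T (m ℕ.+ suc d)            ∎

  block : ∀ m U .{{_ : NonZero U}} → (∀ i → m ℕ.≤ i → q i ≤ 1 ⁄ U) →
          ∀ d → T (d ℕ.+ m) ≤ T m + d ⁄ U
  block m U small zero    = ℚ.≤-reflexive (sym (trans (cong (T m +_) (⁄-≡ 0 U 0 1 refl)) (ℚ.+-identityʳ (T m))))
  block m U small (suc d) = begin
    T (suc d ℕ.+ m)                  ≡⟨ T-suc (d ℕ.+ m) ⟩
    T (d ℕ.+ m) + q (d ℕ.+ m)        ≤⟨ ℚ.+-mono-≤ (block m U small d) (small (d ℕ.+ m) (ℕ.m≤n+m m d)) ⟩
    T m + d ⁄ U + 1 ⁄ U              ≡⟨ ℚ.+-assoc (T m) _ _ ⟩
    T m + (d ⁄ U + 1 ⁄ U)            ≡⟨ cong (T m +_) (trans (⁄-+ d U 1) (cong (_⁄ U) (ℕ.+-comm d 1))) ⟩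
    T m + suc d ⁄ U                  ∎
    where open ℚ.≤-Reasoning

  E : ℕ → ℚ
  E J = ((2 ℕ.^ suc b) ⁄ (2 ℕ.^ J)) {{ℕ.m^n≢0 2 J}}

  P : ℕ → ℕ
  P J = 2 ℕ.^ (b ℕ.* J)

  step : ∀ J → T (P (suc J)) + E (suc J) ≤ T (P J) + E J
  step J = begin
    T (P (suc J)) + E (suc J)              ≤⟨ ℚ.+-monoˡ-≤ (E (suc J)) (T-mono (ℕ.m≤m+n _ (P J))) ⟩
    T (P (suc J) ℕ.+ P J) + E (suc J)      ≤⟨ ℚ.+-monoˡ-≤ (E (suc J)) (block (P J) U (decay J) (P (suc J))) ⟩
    T (P J) + P (suc J) ⁄ U + E (suc J)    ≡⟨ cong₂ (λ u v → T (P J) + u + v) count half ⟩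
    T (P J) + X + X                        ≡⟨ ℚ.+-assoc (T (P J)) X X ⟩
    T (P J) + (X + X)                      ≡⟨ cong (T (P J) +_) X+X ⟩
    T (P J) + E J                          ∎
    where
    open ℚ.≤-Reasoning
    U = 2 ℕ.^ (suc b ℕ.* J)
    instance
      U≢0 : NonZero U
      U≢0 = ℕ.m^n≢0 2 (suc b ℕ.* J)
      2^J≢0 : NonZero (2 ℕ.^ J)
      2^J≢0 = ℕ.m^n≢0 2 J
      2^1+J≢0 : NonZero (2 ℕ.^ suc J)
      2^1+J≢0 = ℕ.m^n≢0 2 (suc J)
    X : ℚ
    X = (2 ℕ.^ b) ⁄ (2 ℕ.^ J)
    count : P (suc J) ⁄ U ≡ X
    count = ⁄-≡ (P (suc J)) U (2 ℕ.^ b) (2 ℕ.^ J)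
      (trans (sym (ℕ.^-distribˡ-+-* 2 (b ℕ.* suc J) J))
      (trans (cong (2 ℕ.^_) (trans (cong (ℕ._+ J) (ℕ.*-suc b J))
        (trans (ℕ.+-assoc b (b ℕ.* J) J) (cong (b ℕ.+_) (ℕ.+-comm (b ℕ.* J) J)))))
        (ℕ.^-distribˡ-+-* 2 b (suc b ℕ.* J))))
    half : E (suc J) ≡ X
    half = ⁄-≡ (2 ℕ.^ suc b) (2 ℕ.^ suc J) (2 ℕ.^ b) (2 ℕ.^ J)
      (trans (cong (ℕ._* 2 ℕ.^ J) (ℕ.*-comm 2 (2 ℕ.^ b))) (ℕ.*-assoc (2 ℕ.^ b) 2 (2 ℕ.^ J)))
    X+X : X + X ≡ E J
    X+X = trans (⁄-+ (2 ℕ.^ b) (2 ℕ.^ J) (2 ℕ.^ b))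
      (cong (_⁄ (2 ℕ.^ J)) (cong (2 ℕ.^ b ℕ.+_) (sym (ℕ.+-identityʳ (2 ℕ.^ b)))))

  steps : ∀ J d → T (P (d ℕ.+ J)) + E (d ℕ.+ J) ≤ T (P J) + E J
  steps J zero    = ℚ.≤-refl
  steps J (suc d) = ℚ.≤-trans (step (d ℕ.+ J)) (steps J d)

  tail : ∀ J m n → P J ℕ.≤ n → T m ≤ T n + E J
  tail J m n P≤n = begin
    T m                              ≤⟨ T-mono m≤P ⟩
    T (P (m ℕ.+ J))                  ≡⟨ ℚ.+-identityʳ (T (P (m ℕ.+ J))) ⟨
    T (P (m ℕ.+ J)) + 0ℚ             ≤⟨ ℚ.+-monoʳ-≤ (T (P (m ℕ.+ J))) (0≤⁄ (2 ℕ.^ suc b) (2 ℕ.^ (m ℕ.+ J)) {{ℕ.m^n≢0 2 (m ℕ.+ J)}}) ⟩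
    T (P (m ℕ.+ J)) + E (m ℕ.+ J)    ≤⟨ steps J m ⟩
    T (P J) + E J                    ≤⟨ ℚ.+-monoˡ-≤ (E J) (T-mono P≤n) ⟩
    T n + E J                        ∎
    where
    open ℚ.≤-Reasoning
    m≤P : m ℕ.≤ P (m ℕ.+ J)
    m≤P = ℕ.≤-trans (n≤2^n m) (ℕ.^-monoʳ-≤ 2 (ℕ.≤-trans (ℕ.m≤m+n m J) (ℕ.m≤n*m (m ℕ.+ J) b)))

module ζ-Convergence (s : ℚ) (1<s : 1ℚ < s) where

  private
    a = ℤ.∣ ↥ s ∣
    b = ↧ₙ s

  b<a : suc b ℕ.≤ a
  b<a = num (↥ s) (subst₂ ℤ._<_ (ℤ.*-identityˡ (ℤ.+ b)) (ℤ.*-identityʳ (↥ s)) (ℚ.drop-*<* 1<s))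
    where
    num : ∀ z → ℤ.+ b ℤ.< z → b ℕ.< ℤ.∣ z ∣
    num (ℤ.+ n) (ℤ.+<+ lt) = lt

  q : ℕ → ℕ → ℚ
  q j i = floorPow (suc i) a b (suc j) ⁄ suc j

  T : ℕ → ℕ → ℚ
  T j n = seq (partialSum (ζ-term s) n) j

  module _ (j : ℕ) where
    open BlockTail b (T j) (q j) (λ n → refl) (λ i → 0≤⁄ (floorPow (suc i) a b (suc j)) (suc j))
      (λ J i P≤i → ⁄-≤ (floorPow (suc i) a b (suc j)) (suc j) 1 (2 ℕ.^ (suc b ℕ.* J)) {{_}} {{ℕ.m^n≢0 2 (suc b ℕ.* J)}}
        (ℕ.≤-trans (floorPow-decay (suc i) a b (suc j) J b<a (ℕ.m≤n⇒m≤1+n P≤i))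
                   (ℕ.≤-reflexive (sym (ℕ.*-identityˡ (suc j))))))
      public

  partialSum-cauchy : Cauchyᴿ (partialSum (ζ-term s))
  partialSum-cauchy ε 0<ε =
    let K , 1/K≤ε = archimedean 0<ε
        J = suc b ℕ.+ suc K
        instance 2^J≢0 = ℕ.m^n≢0 2 J
        E≤ε : (2 ℕ.^ suc b) ⁄ (2 ℕ.^ J) ≤ ε
        E≤ε = ℚ.≤-trans (⁄-≤ (2 ℕ.^ suc b) (2 ℕ.^ J) 1 (suc K) (begin
            2 ℕ.^ suc b ℕ.* suc K          ≤⟨ ℕ.*-monoʳ-≤ (2 ℕ.^ suc b) (n≤2^n (suc K)) ⟩
            2 ℕ.^ suc b ℕ.* 2 ℕ.^ suc K    ≡⟨ ℕ.^-distribˡ-+-* 2 (suc b) (suc K) ⟨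
            2 ℕ.^ J                        ≡⟨ ℕ.*-identityˡ _ ⟨
            1 ℕ.* 2 ℕ.^ J                  ∎)) 1/K≤ε
    in 2 ℕ.^ (b ℕ.* J) , λ m n P≤m P≤n δ 0<δ → 0 , λ j _ →
      ℚ.≤-trans
        (∣-∣≤ (T j m) (T j n)
          (ℚ.≤-trans (tail j J m n P≤n) (ℚ.+-monoʳ-≤ (T j n) E≤ε))
          (ℚ.≤-trans (tail j J n m P≤m) (ℚ.+-monoʳ-≤ (T j m) E≤ε)))
        (subst (_≤ ε + δ) (ℚ.+-identityʳ ε) (ℚ.+-monoʳ-≤ ε (ℚ.<⇒≤ 0<δ)))
    where open ℕ.≤-Reasoning

  1≤partialSum : ∀ n j → 1ℚ ≤ T j (suc n)
  1≤partialSum n j = subst (_≤ T j (suc n)) T1≡1 (T-mono j {1} {suc n} (s≤s z≤n))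
    where
    T1≡1 : T j 1 ≡ 1ℚ
    T1≡1 = trans (ℚ.+-identityˡ (q j 0))
      (⁄-≡ (floorPow 1 a b (suc j)) (suc j) 1 1
        (trans (ℕ.*-identityʳ _) (trans (floorPow-1 a b j) (sym (ℕ.*-identityˡ (suc j))))))

ζ : (s : ℚ) → 1ℚ < s → ℝ
ζ s 1<s = lim (partialSum (ζ-term s)) (ζ-Convergence.partialSum-cauchy s 1<s)

0<ζ : ∀ s (1<s : 1ℚ < s) → fromℚ 0ℚ <ᴿ ζ s 1<s
0<ζ s 1<s = 1ℚ , ℚ.positive⁻¹ 1ℚ , 1 , λ where
  (suc n) _ → subst (_≤ seq (ζ s 1<s) (suc n)) (sym (ℚ.+-identityˡ 1ℚ))
                (ζ-Convergence.1≤partialSum s 1<s n _)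

------------------------------------------------------------------------
-- The product over all primes

-- The product of f p over the primes p < n, in increasing order.
primeProduct : (∀ p → Prime p → ℚ) → ℕ → ℚ
primeProduct f zero    = 1ℚ
primeProduct f (suc n) with prime? n
... | yes pr = primeProduct f n * f n pr
... | no  _  = primeProduct f n

euler-denominator≢0 : ∀ k p → Prime p → NonZero (suc p ℕ.* p ℕ.^ k)
euler-denominator≢0 k p pr = ℕ.m*n≢0 (suc p) (p ℕ.^ k)
  {{_}} {{ℕ.m^n≢0 p k {{prime⇒nonZero pr}}}}

euler-factor : ℕ → ∀ p → Prime p → ℚ
euler-factor k p pr = 1ℚ - ((2 ℕ.* p) ⁄ (suc p ℕ.* p ℕ.^ k)) {{euler-denominator≢0 k p pr}}

module EulerProduct-Convergence (k : ℕ) (1<k : 1 ℕ.< k) where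

  -- 1 - euler-factor is at most 2 / (p (p - 1)), whose sum telescopes to D.
  W : ℕ → ℚ
  W = primeProduct (euler-factor k)

  D : ℕ → ℚ
  D i = 2 ⁄ suc i

  u : ∀ p → Prime p → ℚ
  u p pr = ((2 ℕ.* p) ⁄ (suc p ℕ.* p ℕ.^ k)) {{euler-denominator≢0 k p pr}}

  p²≤p^k : ∀ p .{{_ : NonZero p}} → p ℕ.* p ℕ.≤ p ℕ.^ k
  p²≤p^k p = ℕ.≤-trans (ℕ.≤-reflexive (cong (p ℕ.*_) (sym (ℕ.*-identityʳ p))))
                       (ℕ.^-monoʳ-≤ p 1<k)

  0≤u : ∀ p pr → 0ℚ ≤ u p pr
  0≤u p pr = 0≤⁄ (2 ℕ.* p) (suc p ℕ.* p ℕ.^ k) {{euler-denominator≢0 k p pr}}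

  u≤ : ∀ i (pr : Prime (2 ℕ.+ i)) → u (2 ℕ.+ i) pr ≤ (2 ⁄ (suc i ℕ.* (2 ℕ.+ i)))
  u≤ i pr = ⁄-≤ (2 ℕ.* p) (suc p ℕ.* p ℕ.^ k) 2 (suc i ℕ.* p) {{euler-denominator≢0 k p pr}} (begin
    2 ℕ.* p ℕ.* (suc i ℕ.* p)      ≡⟨ ℕ.*-assoc 2 p (suc i ℕ.* p) ⟩
    2 ℕ.* (p ℕ.* (suc i ℕ.* p))    ≤⟨ ℕ.*-monoʳ-≤ 2 (ℕ.*-mono-≤ (ℕ.n≤1+n p)
                                        (ℕ.≤-trans (ℕ.*-monoˡ-≤ p (ℕ.n≤1+n (suc i))) (p²≤p^k p))) ⟩
    2 ℕ.* (suc p ℕ.* p ℕ.^ k)      ∎)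
    where
    open ℕ.≤-Reasoning
    p = 2 ℕ.+ i

  u≤1 : ∀ p pr → u p pr ≤ 1ℚ
  u≤1 zero pr = contradiction (prime⇒nonZero pr) λ ()
  u≤1 p@(suc p′) pr = ⁄-≤ (2 ℕ.* p) (suc p ℕ.* p ℕ.^ k) 1 1 {{euler-denominator≢0 k p pr}} (begin
    2 ℕ.* p ℕ.* 1                   ≡⟨ ℕ.*-identityʳ (2 ℕ.* p) ⟩
    2 ℕ.* p                         ≤⟨ ℕ.*-mono-≤ (s≤s (s≤s (z≤n {p′}))) (ℕ.≤-trans (ℕ.m≤m*n p p) (p²≤p^k p)) ⟩
    suc p ℕ.* p ℕ.^ k               ≡⟨ ℕ.*-identityˡ _ ⟨
    1 ℕ.* (suc p ℕ.* p ℕ.^ k)       ∎)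
    where open ℕ.≤-Reasoning

  0≤factor : ∀ p pr → 0ℚ ≤ euler-factor k p pr
  0≤factor p pr = subst (_≤ euler-factor k p pr) (ℚ.+-inverseʳ (u p pr))
    (ℚ.+-monoˡ-≤ (- u p pr) (u≤1 p pr))

  factor≤1 : ∀ p pr → euler-factor k p pr ≤ 1ℚ
  factor≤1 p pr = ≤-by-- 1ℚ (u p pr)
    (subst (_≤ u p pr + 1ℚ) (ℚ.+-identityˡ 1ℚ) (ℚ.+-monoˡ-≤ 1ℚ (0≤u p pr)))

  W-bounds : ∀ n → 0ℚ ≤ W n × W n ≤ 1ℚ
  W-bounds zero    = ℚ.nonNegative⁻¹ 1ℚ , ℚ.≤-refl
  W-bounds (suc n) with prime? n | W-bounds n
  ... | no  _  | bounds    = bounds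
  ... | yes pr | 0≤W , W≤1 = 0≤* 0≤W (0≤factor n pr) ,
    *-mono-≤ 0≤W W≤1 (0≤factor n pr) (factor≤1 n pr)

  W-anti : ∀ n d → W (d ℕ.+ n) ≤ W n
  W-anti n zero    = ℚ.≤-refl
  W-anti n (suc d) = ℚ.≤-trans (step (d ℕ.+ n)) (W-anti n d)
    where
    step : ∀ m → W (suc m) ≤ W m
    step m with prime? m
    ... | no  _  = ℚ.≤-refl
    ... | yes pr = subst (W m * euler-factor k m pr ≤_) (ℚ.*-identityʳ (W m))
      (ℚ.*-monoˡ-≤-nonNeg (W m) {{nonNegative (proj₁ (W-bounds m))}} (factor≤1 m pr))

  D-step : ∀ i → D (suc i) + 2 ⁄ (suc i ℕ.* (2 ℕ.+ i)) ≡ D i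
  D-step i = begin
    2 ⁄ (2 ℕ.+ i) + 2 ⁄ e              ≡⟨ cong (_+ 2 ⁄ e) (⁄-≡ 2 (2 ℕ.+ i) (2 ℕ.* suc i) e (sym (ℕ.*-assoc 2 (suc i) (2 ℕ.+ i)))) ⟩
    (2 ℕ.* suc i) ⁄ e + 2 ⁄ e          ≡⟨ ⁄-+ (2 ℕ.* suc i) e 2 ⟩
    (2 ℕ.* suc i ℕ.+ 2) ⁄ e            ≡⟨ ⁄-≡ (2 ℕ.* suc i ℕ.+ 2) e 2 (suc i) count ⟩
    2 ⁄ suc i                          ∎
    where
    open ≡-Reasoning
    e = suc i ℕ.* (2 ℕ.+ i)
    count : (2 ℕ.* suc i ℕ.+ 2) ℕ.* suc i ≡ 2 ℕ.* e
    count = trans (cong (ℕ._* suc i) (trans (ℕ.+-comm (2 ℕ.* suc i) 2) (sym (ℕ.*-suc 2 (suc i)))))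
      (trans (ℕ.*-assoc 2 (2 ℕ.+ i) (suc i)) (cong (2 ℕ.*_) (ℕ.*-comm (2 ℕ.+ i) (suc i))))

  W-step : ∀ i → W (2 ℕ.+ i) + D (suc i) ≤ W (3 ℕ.+ i) + D i
  W-step i with prime? (2 ℕ.+ i)
  ... | no  _  = ℚ.+-monoʳ-≤ (W (2 ℕ.+ i))
    (subst₂ _≤_ (ℚ.+-identityʳ (D (suc i))) (D-step i)
      (ℚ.+-monoʳ-≤ (D (suc i)) (0≤⁄ 2 (suc i ℕ.* (2 ℕ.+ i)))))
  ... | yes pr = begin
    w + D (suc i)                        ≡⟨ solve 3 (λ w v d → w :+ d := w :* (con 1ℚ :- v) :+ (d :+ w :* v)) refl w v (D (suc i)) ⟩
    w * (1ℚ - v) + (D (suc i) + w * v)   ≤⟨ ℚ.+-monoʳ-≤ (w * (1ℚ - v)) (ℚ.+-monoʳ-≤ (D (suc i)) wv≤) ⟩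
    w * (1ℚ - v) + (D (suc i) + 2 ⁄ (suc i ℕ.* (2 ℕ.+ i)))
                                         ≡⟨ cong (w * (1ℚ - v) +_) (D-step i) ⟩
    w * (1ℚ - v) + D i                   ∎
    where
    open ℚ.≤-Reasoning
    open +-*-Solver
    w = W (2 ℕ.+ i)
    v = u (2 ℕ.+ i) pr
    wv≤ : w * v ≤ 2 ⁄ (suc i ℕ.* (2 ℕ.+ i))
    wv≤ = ℚ.≤-trans
      (ℚ.*-monoʳ-≤-nonNeg v {{nonNegative (0≤u (2 ℕ.+ i) pr)}} (proj₂ (W-bounds (2 ℕ.+ i))))
      (ℚ.≤-trans (ℚ.≤-reflexive (ℚ.*-identityˡ v)) (u≤ i pr))

  W-tail : ∀ i d → W (2 ℕ.+ i) + D (d ℕ.+ i) ≤ W (2 ℕ.+ (d ℕ.+ i)) + D i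
  W-tail i zero    = ℚ.≤-refl
  W-tail i (suc d) = chain (W (2 ℕ.+ i)) (W (2 ℕ.+ (d ℕ.+ i))) (W (2 ℕ.+ (suc d ℕ.+ i)))
    (D (d ℕ.+ i)) (D (suc d ℕ.+ i)) (D i) (W-tail i d) (W-step (d ℕ.+ i))
    where
    open +-*-Solver
    chain : ∀ a b c x y z → a + x ≤ b + z → b + y ≤ c + x → a + y ≤ c + z
    chain a b c x y z p q = subst₂ _≤_
      (solve 4 (λ a b x y → ((a :+ x) :+ (b :+ y)) :- (x :+ b) := a :+ y) refl a b x y)
      (solve 4 (λ b c x z → ((b :+ z) :+ (c :+ x)) :- (x :+ b) := c :+ z) refl b c x z)
      (ℚ.+-monoˡ-≤ (- (x + b)) (ℚ.+-mono-≤ p q))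

  tail : ∀ i m n → 2 ℕ.+ i ℕ.≤ m → 2 ℕ.+ i ℕ.≤ n → W m ≤ W n + D i
  tail i m n ≤m ≤n = begin
    W m                           ≡⟨ cong W (ℕ.m∸n+n≡m ≤m) ⟨
    W (m ℕ.∸ (2 ℕ.+ i) ℕ.+ (2 ℕ.+ i))
                                  ≤⟨ W-anti (2 ℕ.+ i) (m ℕ.∸ (2 ℕ.+ i)) ⟩
    W (2 ℕ.+ i)                   ≡⟨ ℚ.+-identityʳ (W (2 ℕ.+ i)) ⟨
    W (2 ℕ.+ i) + 0ℚ              ≤⟨ ℚ.+-monoʳ-≤ (W (2 ℕ.+ i)) (0≤⁄ 2 (suc (d ℕ.+ i))) ⟩
    W (2 ℕ.+ i) + D (d ℕ.+ i)     ≤⟨ W-tail i d ⟩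
    W (2 ℕ.+ (d ℕ.+ i)) + D i     ≡⟨ cong (λ l → W l + D i) d+i ⟩
    W n + D i                     ∎
    where
    open ℚ.≤-Reasoning
    d = n ℕ.∸ (2 ℕ.+ i)
    d+i : 2 ℕ.+ (d ℕ.+ i) ≡ n
    d+i = trans (trans (cong (2 ℕ.+_) (ℕ.+-comm d i)) (ℕ.+-comm (2 ℕ.+ i) d)) (ℕ.m∸n+n≡m ≤n)

  W-cauchy : ∀ ε → 0ℚ < ε → ∃[ N ] (∀ m n → N ℕ.≤ m → N ℕ.≤ n → ∣ W m - W n ∣ ≤ ε)
  W-cauchy ε 0<ε =
    let K , 1/K≤ε = archimedean 0<ε
        i = K ℕ.+ suc K
        D≤ε : D i ≤ ε
        D≤ε = ℚ.≤-trans (⁄-≤ 2 (suc i) 1 (suc K) (ℕ.≤-reflexive (trans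
          (cong (suc K ℕ.+_) (ℕ.+-identityʳ (suc K))) (sym (ℕ.+-identityʳ (suc i)))))) 1/K≤ε
    in 2 ℕ.+ i , λ m n ≤m ≤n → ∣-∣≤ (W m) (W n)
      (ℚ.≤-trans (tail i m n ≤m ≤n) (ℚ.+-monoʳ-≤ (W n) D≤ε))
      (ℚ.≤-trans (tail i n m ≤n ≤m) (ℚ.+-monoʳ-≤ (W m) D≤ε))

-- The partial products are rational, so they are themselves the approximants.
eulerProduct : ∀ k → 1 ℕ.< k → ℝ
eulerProduct k 1<k = mkℝ (primeProduct (euler-factor k))
  (EulerProduct-Convergence.W-cauchy k 1<k)

------------------------------------------------------------------------
-- The constants c k

recipℕ : ∀ k → 1 ℕ.< k → ℚ
recipℕ k 1<k = (1 ⁄ k) {{ℕ.>-nonZero (ℕ.<⇒≤ 1<k)}}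

1<k⁄1 : ∀ {k} → 1 ℕ.< k → 1ℚ < k ⁄ 1
1<k⁄1 {k} 1<k = ℚ.<-≤-trans {1ℚ} {2 ⁄ 1} (ℚ.toℚᵘ-cancel-< (ℚᵘ.*<* (ℤ.+<+ (s≤s (s≤s z≤n)))))
  (⁄-≤ 2 1 k 1 (ℕ.*-monoˡ-≤ 1 1<k))

1<2-1/k : ∀ k (1<k : 1 ℕ.< k) → 1ℚ < 2 ⁄ 1 - recipℕ k 1<k
1<2-1/k k 1<k = ℚ.<-≤-trans {1ℚ} {2 ⁄ 1 - 1 ⁄ 2} (ℚ.toℚᵘ-cancel-< (ℚᵘ.*<* (ℤ.+<+ (s≤s (s≤s (s≤s z≤n))))))
  (ℚ.+-monoʳ-≤ (2 ⁄ 1) (ℚ.neg-antimono-≤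
    (⁄-≤ 1 k 1 2 {{ℕ.>-nonZero (ℕ.<⇒≤ 1<k)}} (ℕ.≤-trans 1<k (ℕ.≤-reflexive (sym (ℕ.*-identityˡ k)))))))

2k-1≢0 : ∀ k → 1 ℕ.< k → NonZero (2 ℕ.* k ℕ.∸ 1)
2k-1≢0 (suc (suc k)) 1<k = _
2k-1≢0 (suc zero) (s≤s ())

c : ∀ k → 1 ℕ.< k → ℝ
c k 1<k =
     fromℚ (((2 ℕ.* k) ⁄ (2 ℕ.* k ℕ.∸ 1)) {{2k-1≢0 k 1<k}})
  *ᴿ (ζ (2 ⁄ 1 - recipℕ k 1<k) (1<2-1/k k 1<k) *ᴿ recip (ζ (2 ⁄ 1) 1<2) (0<ζ (2 ⁄ 1) 1<2))
  *ᴿ (ζ (k ⁄ 1) (1<k⁄1 1<k) *ᴿ ζ (k ⁄ 1) (1<k⁄1 1<k))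
  *ᴿ eulerProduct k 1<k
  where
  1<2 : 1ℚ < 2 ⁄ 1
  1<2 = 1<k⁄1 ℕ.≤-refl

{-# OPTIONS --safe #-}
-- Each of the factors 2k / (2k - 1), ζ(2 - 1/k) / ζ(2), ζ(k) and ∏ₚ is
-- 1 + O(1/k).  For ζ(k) and the product over primes, k n² ≤ 4 nᵏ for n ≥ 2
-- compares the deviation from 1 with (1/k) Σ 1 / (i (i + 1)).  For the quotient,
-- (1 + u)ᵏ ≥ k² u² / 4 gives n^(1/k) ≤ 1 + 2 √n / k, hence
-- ζ(2) ≤ ζ(2 - 1/k) ≤ ζ(2) + (2/k) ζ(3/2).  All this is done on the rational
-- approximants, for indices n ≥ k, so rounding errors O(1/n) are also O(1/k).
module Submission where

open import Defs
open import Data.Nat.Base as ℕ using (ℕ; zero; suc; NonZero; z≤n; s≤s; _<_)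
import Data.Nat.Properties as ℕ
import Data.Nat.Solver as ℕ
import Data.Integer.Base as ℤ
import Data.Integer.Properties as ℤ
open import Data.Nat.Primality using (prime?)
open import Data.Product.Base using (Σ-syntax; _,_; proj₁; proj₂)
open import Data.Rational.Base
  using (ℚ; mkℚ; 0ℚ; 1ℚ; _+_; _*_; _-_; -_; _≤_; ∣_∣; toℚᵘ; ↥_; ↧ₙ_; nonNegative)
import Data.Rational.Base as ℚ using (_<_)
import Data.Rational.Properties as ℚ
open import Data.Rational.Solver using (module +-*-Solver)
import Data.Rational.Unnormalised.Base as ℚᵘ
open import Data.Sum.Base using (inj₁; inj₂)
open import Relation.Nullary.Decidable.Core using (yes; no)
open import Relation.Binary.PropositionalEquality
  using (_≡_; refl; sym; trans; cong; cong₂; subst; subst₂; module ≡-Reasoning)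

-- Rational exponents and their reduced fractions.

-- `ζ-term` reads off the reduced numerator and denominator of `s`, which do not compute when `p`
-- and `q` contain a variable; this relation is what `Below-cong` needs to pass between them and
-- `p`, `q`.
⁄-cross : ∀ {s} p q .{{_ : NonZero q}} → s ≡ p ⁄ q → ℤ.∣ ↥ s ∣ ℕ.* q ≡ p ℕ.* ↧ₙ s
⁄-cross {s} p q@(suc q′) eq = cross s
  (subst (λ x → toℚᵘ x ℚᵘ.≃ ℚᵘ.mkℚᵘ (ℤ.+ p) q′) (sym eq) (ℚ.toℚᵘ-fromℚᵘ (ℚᵘ.mkℚᵘ (ℤ.+ p) q′)))
  where
  cross : ∀ s → toℚᵘ s ℚᵘ.≃ ℚᵘ.mkℚᵘ (ℤ.+ p) q′ → ℤ.∣ ↥ s ∣ ℕ.* q ≡ p ℕ.* ↧ₙ s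
  cross s@(mkℚ _ _ _) (ℚᵘ.*≡* eq) = trans (sym (ℤ.abs-* (↥ s) (ℤ.+ q)))
    (trans (cong ℤ.∣_∣ eq) (ℤ.abs-* (ℤ.+ p) (ℤ.+ ↧ₙ s)))

-- Both conditions bound r / M by the same power of n: the q-th power of the hypothesis is the b-th
-- power of the conclusion, and b-th roots preserve order.
Below-cong : ∀ n a b p q .{{_ : NonZero n}} .{{_ : NonZero b}} .{{_ : NonZero q}} →
  a ℕ.* q ≡ p ℕ.* b → ∀ M r → Below n a b M r → Below n p q M r
Below-cong n a b p q aq≡pb M r below = ^-cancelˡ-≤ b (begin
  (r ℕ.^ q ℕ.* n ℕ.^ p) ℕ.^ b            ≡⟨ pow q p b ⟩
  r ℕ.^ (q ℕ.* b) ℕ.* n ℕ.^ (p ℕ.* b)    ≡⟨ cong₂ (λ x y → r ℕ.^ x ℕ.* n ℕ.^ y) (ℕ.*-comm q b) (sym aq≡pb) ⟩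
  r ℕ.^ (b ℕ.* q) ℕ.* n ℕ.^ (a ℕ.* q)    ≡⟨ pow b a q ⟨
  (r ℕ.^ b ℕ.* n ℕ.^ a) ℕ.^ q            ≤⟨ ℕ.^-monoˡ-≤ q below ⟩
  (M ℕ.^ b) ℕ.^ q                        ≡⟨ ℕ.^-*-assoc M b q ⟩
  M ℕ.^ (b ℕ.* q)                        ≡⟨ cong (M ℕ.^_) (ℕ.*-comm b q) ⟩
  M ℕ.^ (q ℕ.* b)                        ≡⟨ ℕ.^-*-assoc M q b ⟨
  (M ℕ.^ q) ℕ.^ b                        ∎)
  where
  open ℕ.≤-Reasoning
  pow : ∀ x y z → (r ℕ.^ x ℕ.* n ℕ.^ y) ℕ.^ z ≡ r ℕ.^ (x ℕ.* z) ℕ.* n ℕ.^ (y ℕ.* z)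
  pow x y z = trans (^-distribʳ-* z (r ℕ.^ x) (n ℕ.^ y))
    (cong₂ ℕ._*_ (ℕ.^-*-assoc r x z) (ℕ.^-*-assoc n y z))

-- Binomial inequalities and growth of powers.

-- The left side is the term linear in y of the binomial expansion; the induction splits off one
-- factor x + y.
binomial-linear : ∀ m x y → suc m ℕ.* (x ℕ.^ m ℕ.* y) ℕ.≤ (x ℕ.+ y) ℕ.^ suc m
binomial-linear zero    x y = ℕ.≤-trans (ℕ.≤-reflexive (solve 1 (λ y → con 1 :* (con 1 :* y) := y) refl y))
  (ℕ.≤-trans (ℕ.m≤n+m y x) (ℕ.≤-reflexive (sym (ℕ.*-identityʳ (x ℕ.+ y)))))
  where open ℕ.+-*-Solver
binomial-linear (suc m) x y = begin
  suc (suc m) ℕ.* (x ℕ.* X ℕ.* y)                  ≡⟨ solve 4 (λ m x X y → (con 2 :+ m) :* (x :* X :* y) := x :* ((con 1 :+ m) :* (X :* y)) :+ y :* (x :* X)) refl m x X y ⟩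
  x ℕ.* (suc m ℕ.* (X ℕ.* y)) ℕ.+ y ℕ.* x ℕ.^ suc m ≤⟨ ℕ.+-mono-≤ (ℕ.*-monoʳ-≤ x (binomial-linear m x y)) (ℕ.*-monoʳ-≤ y (ℕ.^-monoˡ-≤ (suc m) (ℕ.m≤m+n x y))) ⟩
  x ℕ.* Y ℕ.+ y ℕ.* Y                              ≡⟨ ℕ.*-distribʳ-+ Y x y ⟨
  (x ℕ.+ y) ℕ.* Y                                  ∎
  where
  open ℕ.≤-Reasoning
  open ℕ.+-*-Solver
  X = x ℕ.^ m
  Y = (x ℕ.+ y) ℕ.^ suc m

-- The term quadratic in y, doubled to clear the denominator of the binomial coefficient. In the
-- induction (m + 3)(m + 2) = (m + 2)(m + 1) + 2 (m + 2), and the second share is paid by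
-- `binomial-linear`.
binomial-quadratic : ∀ m x y →
  (2 ℕ.+ m) ℕ.* suc m ℕ.* (x ℕ.^ m ℕ.* (y ℕ.* y)) ℕ.≤ 2 ℕ.* (x ℕ.+ y) ℕ.^ (2 ℕ.+ m)
binomial-quadratic zero    x y = begin
  2 ℕ.* 1 ℕ.* (1 ℕ.* (y ℕ.* y))     ≡⟨ solve 1 (λ y → con 2 :* con 1 :* (con 1 :* (y :* y)) := con 2 :* (y :* (y :* con 1))) refl y ⟩
  2 ℕ.* y ℕ.^ 2                     ≤⟨ ℕ.*-monoʳ-≤ 2 (ℕ.^-monoˡ-≤ 2 (ℕ.m≤n+m y x)) ⟩
  2 ℕ.* (x ℕ.+ y) ℕ.^ 2             ∎
  where
  open ℕ.≤-Reasoning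
  open ℕ.+-*-Solver
binomial-quadratic (suc m) x y = begin
  (3 ℕ.+ m) ℕ.* (2 ℕ.+ m) ℕ.* (x ℕ.* X ℕ.* (y ℕ.* y))
    ≡⟨ solve 4 (λ m x X y → (con 3 :+ m) :* (con 2 :+ m) :* (x :* X :* (y :* y))
         := x :* ((con 2 :+ m) :* (con 1 :+ m) :* (X :* (y :* y))) :+ con 2 :* y :* ((con 2 :+ m) :* (x :* X :* y)))
         refl m x X y ⟩
  x ℕ.* ((2 ℕ.+ m) ℕ.* suc m ℕ.* (X ℕ.* (y ℕ.* y))) ℕ.+ 2 ℕ.* y ℕ.* ((2 ℕ.+ m) ℕ.* (x ℕ.* X ℕ.* y))
    ≤⟨ ℕ.+-mono-≤ (ℕ.*-monoʳ-≤ x (binomial-quadratic m x y)) (ℕ.*-monoʳ-≤ (2 ℕ.* y) (binomial-linear (suc m) x y)) ⟩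
  x ℕ.* (2 ℕ.* Y) ℕ.+ 2 ℕ.* y ℕ.* Y
    ≡⟨ solve 3 (λ x y Y → x :* (con 2 :* Y) :+ con 2 :* y :* Y := con 2 :* ((x :+ y) :* Y)) refl x y Y ⟩
  2 ℕ.* ((x ℕ.+ y) ℕ.* Y)
    ∎
  where
  open ℕ.≤-Reasoning
  open ℕ.+-*-Solver
  X = x ℕ.^ m
  Y = (x ℕ.+ y) ℕ.^ (2 ℕ.+ m)

-- With k = m + 2, k² ≤ 2 k (k - 1), the difference being m (m + 2).
square-bound : ∀ m x y → (2 ℕ.+ m) ℕ.* (2 ℕ.+ m) ℕ.* (x ℕ.^ m ℕ.* (y ℕ.* y)) ℕ.≤ 4 ℕ.* (x ℕ.+ y) ℕ.^ (2 ℕ.+ m)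
square-bound m x y = begin
  (2 ℕ.+ m) ℕ.* (2 ℕ.+ m) ℕ.* Z             ≤⟨ ℕ.m≤m+n _ (m ℕ.* (2 ℕ.+ m) ℕ.* Z) ⟩
  (2 ℕ.+ m) ℕ.* (2 ℕ.+ m) ℕ.* Z ℕ.+ m ℕ.* (2 ℕ.+ m) ℕ.* Z
                                            ≡⟨ solve 2 (λ m Z → (con 2 :+ m) :* (con 2 :+ m) :* Z :+ m :* (con 2 :+ m) :* Z
                                                 := con 2 :* ((con 2 :+ m) :* (con 1 :+ m) :* Z)) refl m Z ⟩
  2 ℕ.* ((2 ℕ.+ m) ℕ.* suc m ℕ.* Z)         ≤⟨ ℕ.*-monoʳ-≤ 2 (binomial-quadratic m x y) ⟩
  2 ℕ.* (2 ℕ.* (x ℕ.+ y) ℕ.^ (2 ℕ.+ m))     ≡⟨ ℕ.*-assoc 2 2 ((x ℕ.+ y) ℕ.^ (2 ℕ.+ m)) ⟨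
  4 ℕ.* (x ℕ.+ y) ℕ.^ (2 ℕ.+ m)             ∎
  where
  open ℕ.≤-Reasoning
  open ℕ.+-*-Solver
  Z = x ℕ.^ m ℕ.* (y ℕ.* y)

square-cancel-≤ : ∀ {x y} → x ℕ.* x ℕ.≤ y ℕ.* y → x ℕ.≤ y
square-cancel-≤ {x} {y} le = ^-cancelˡ-≤ 2 (subst₂ ℕ._≤_
  (cong (x ℕ.*_) (sym (ℕ.*-identityʳ x))) (cong (y ℕ.*_) (sym (ℕ.*-identityʳ y))) le)

-- n^(1/k) ≤ 1 + 2 √n / k, multiplied by M n⁻²: r / M, R / M and S / M stand for
-- n^(-(2k-1)/k), n⁻² and n^(-3/2), rounded down, up and up.
pow-excess : ∀ m M n .{{_ : NonZero M}} .{{_ : NonZero n}} {r R S} → let k = 2 ℕ.+ m in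
  r ℕ.^ k ℕ.* n ℕ.^ (2 ℕ.* k ℕ.∸ 1) ℕ.≤ M ℕ.^ k →
  M ℕ.≤ R ℕ.* n ℕ.^ 2 → M ℕ.^ 2 ℕ.≤ S ℕ.^ 2 ℕ.* n ℕ.^ 3 →
  k ℕ.* r ℕ.≤ k ℕ.* R ℕ.+ 2 ℕ.* S
pow-excess m M n {r} {R} {S} hr hR hS with ℕ.≤-total r R
... | inj₁ r≤R = ℕ.≤-trans (ℕ.*-monoʳ-≤ (2 ℕ.+ m) r≤R) (ℕ.m≤m+n _ _)
... | inj₂ R≤r with ℕ.m≤n⇒∃[o]m+o≡n R≤r
-- Here ρ = r - R, and k ρ ≤ 2 S remains. It is squared and multiplied by M^m N², N = n², so that
-- `square-bound` applies with y = ρ N; `hR` gives M + ρ N ≤ r N, whose k-th power is r^k n^(2k - 1)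
-- times n.
...   | ρ , refl = ℕ.≤-trans (ℕ.≤-reflexive (ℕ.*-distribˡ-+ k R ρ))
  (ℕ.+-monoʳ-≤ (k ℕ.* R) (square-cancel-≤ (ℕ.*-cancelʳ-≤ _ _ (M ℕ.^ m ℕ.* (N ℕ.* N)) (begin
    k ℕ.* ρ ℕ.* (k ℕ.* ρ) ℕ.* (M ℕ.^ m ℕ.* (N ℕ.* N))
      ≡⟨ solve 4 (λ k ρ X N → k :* ρ :* (k :* ρ) :* (X :* (N :* N)) := k :* k :* (X :* (ρ :* N :* (ρ :* N)))) refl k ρ (M ℕ.^ m) N ⟩
    k ℕ.* k ℕ.* (M ℕ.^ m ℕ.* (ρ ℕ.* N ℕ.* (ρ ℕ.* N)))
      ≤⟨ square-bound m M (ρ ℕ.* N) ⟩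
    4 ℕ.* (M ℕ.+ ρ ℕ.* N) ℕ.^ k
      ≤⟨ ℕ.*-monoʳ-≤ 4 (ℕ.^-monoˡ-≤ k (ℕ.≤-trans (ℕ.+-monoˡ-≤ (ρ ℕ.* N) hR) (ℕ.≤-reflexive (sym (ℕ.*-distribʳ-+ N R ρ))))) ⟩
    4 ℕ.* (r ℕ.* N) ℕ.^ k
      ≡⟨ cong (4 ℕ.*_) power ⟩
    4 ℕ.* (r ℕ.^ k ℕ.* n ℕ.^ (2 ℕ.* k ℕ.∸ 1) ℕ.* n)
      ≤⟨ ℕ.*-monoʳ-≤ 4 (ℕ.*-monoˡ-≤ n hr) ⟩
    4 ℕ.* (M ℕ.^ k ℕ.* n)
      ≡⟨ solve 3 (λ M X n → con 4 :* (M :* (M :* X) :* n) := con 4 :* X :* n :* (M :* (M :* con 1))) refl M (M ℕ.^ m) n ⟩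
    4 ℕ.* M ℕ.^ m ℕ.* n ℕ.* M ℕ.^ 2
      ≤⟨ ℕ.*-monoʳ-≤ (4 ℕ.* M ℕ.^ m ℕ.* n) hS ⟩
    4 ℕ.* M ℕ.^ m ℕ.* n ℕ.* (S ℕ.^ 2 ℕ.* n ℕ.^ 3)
      ≡⟨ solve 3 (λ X n S → con 4 :* X :* n :* (S :* (S :* con 1) :* (n :* (n :* (n :* con 1))))
           := con 2 :* S :* (con 2 :* S) :* (X :* (n :* (n :* con 1) :* (n :* (n :* con 1))))) refl (M ℕ.^ m) n S ⟩
    2 ℕ.* S ℕ.* (2 ℕ.* S) ℕ.* (M ℕ.^ m ℕ.* (N ℕ.* N))
      ∎))))
  where
  open ℕ.≤-Reasoning
  open ℕ.+-*-Solver
  k = 2 ℕ.+ m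
  N = n ℕ.^ 2
  instance
    M^m*N²≢0 : NonZero (M ℕ.^ m ℕ.* (N ℕ.* N))
    M^m*N²≢0 = ℕ.m*n≢0 (M ℕ.^ m) (N ℕ.* N) {{ℕ.m^n≢0 M m}} {{ℕ.m*n≢0 N N {{ℕ.m^n≢0 n 2}} {{ℕ.m^n≢0 n 2}}}}
  power : (r ℕ.* N) ℕ.^ k ≡ r ℕ.^ k ℕ.* n ℕ.^ (2 ℕ.* k ℕ.∸ 1) ℕ.* n
  power = trans (^-distribʳ-* k r N) (trans (cong (r ℕ.^ k ℕ.*_)
    (trans (ℕ.^-*-assoc n 2 k) (ℕ.*-comm n (n ℕ.^ (2 ℕ.* k ℕ.∸ 1)))))
    (sym (ℕ.*-assoc (r ℕ.^ k) (n ℕ.^ (2 ℕ.* k ℕ.∸ 1)) n)))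

-- For k = m + 2 and n ≥ 2, k ≤ 2^k = 4 · 2^m ≤ 4 n^m. This is the source of the factor 1/k in the
-- bounds for ζ(k) and the Euler product.
k*n²≤4n^k : ∀ m i → (2 ℕ.+ m) ℕ.* ((2 ℕ.+ i) ℕ.* (2 ℕ.+ i)) ℕ.≤ 4 ℕ.* (2 ℕ.+ i) ℕ.^ (2 ℕ.+ m)
k*n²≤4n^k m i = begin
  (2 ℕ.+ m) ℕ.* (n ℕ.* n)           ≤⟨ ℕ.*-monoˡ-≤ (n ℕ.* n) (n≤2^n (2 ℕ.+ m)) ⟩
  2 ℕ.^ (2 ℕ.+ m) ℕ.* (n ℕ.* n)     ≡⟨ solve 2 (λ X n → con 2 :* (con 2 :* X) :* (n :* n) := con 4 :* (n :* n) :* X) refl (2 ℕ.^ m) n ⟩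
  4 ℕ.* (n ℕ.* n) ℕ.* 2 ℕ.^ m       ≤⟨ ℕ.*-monoʳ-≤ (4 ℕ.* (n ℕ.* n)) (ℕ.^-monoˡ-≤ m (s≤s (s≤s (z≤n {i})))) ⟩
  4 ℕ.* (n ℕ.* n) ℕ.* n ℕ.^ m       ≡⟨ solve 2 (λ X n → con 4 :* (n :* n) :* X := con 4 :* (n :* (n :* X))) refl (n ℕ.^ m) n ⟩
  4 ℕ.* n ℕ.^ (2 ℕ.+ m)             ∎
  where
  open ℕ.≤-Reasoning
  open ℕ.+-*-Solver
  n = 2 ℕ.+ i

-- Telescoping.

-- The increment allowed by the hypothesis is exactly `c * (D i - D (suc i))`, so `f n + c * D n`
-- never increases.
telescope : ∀ {c} (f : ℕ → ℚ) → 0ℚ ≤ c →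
  (∀ i → f (suc i) ≤ f i + c * 2 ⁄ (suc i ℕ.* (2 ℕ.+ i))) → ∀ n → f n ≤ f 0 + c * 2 ⁄ 1
telescope {c} f 0≤c step n = begin
  f n               ≡⟨ ℚ.+-identityʳ (f n) ⟨
  f n + 0ℚ          ≤⟨ ℚ.+-monoʳ-≤ (f n) (0≤* 0≤c (0≤⁄ 2 (suc n))) ⟩
  f n + c * D n     ≤⟨ go n ⟩
  f 0 + c * 2 ⁄ 1   ∎
  where
  -- `D` is the same sequence for every exponent; the smallest admissible one is supplied.
  open EulerProduct-Convergence 2 ℕ.≤-refl using (D; D-step)
  open ℚ.≤-Reasoning
  open +-*-Solver
  go : ∀ n → f n + c * D n ≤ f 0 + c * D 0
  go zero    = ℚ.≤-refl
  go (suc n) = begin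
    f (suc n) + c * D (suc n)       ≤⟨ ℚ.+-monoˡ-≤ (c * D (suc n)) (step n) ⟩
    f n + c * v + c * D (suc n)     ≡⟨ solve 4 (λ f c v d → f :+ c :* v :+ c :* d := f :+ c :* (d :+ v)) refl (f n) c v (D (suc n)) ⟩
    f n + c * (D (suc n) + v)       ≡⟨ cong (λ x → f n + c * x) (D-step n) ⟩
    f n + c * D n                   ≤⟨ go n ⟩
    f 0 + c * D 0                   ∎
    where v = 2 ⁄ (suc n ℕ.* (2 ℕ.+ n))

-- Partial sums of zeta, uniformly in the rounding index.

module _ (s : ℚ) (1<s : 1ℚ ℚ.< s) where

  open ζ-Convergence s 1<s using (T; q)

  partialSum-1 : ∀ j → T j 1 ≡ 1ℚ
  partialSum-1 j = trans (ℚ.+-identityˡ (q j 0))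
    (⁄-≡ (floorPow 1 ℤ.∣ ↥ s ∣ (↧ₙ s) (suc j)) (suc j) 1 1
      (trans (ℕ.*-identityʳ _) (trans (floorPow-1 ℤ.∣ ↥ s ∣ (↧ₙ s) j) (sym (ℕ.*-identityˡ (suc j))))))

  -- The first term is 1. For n = i + 2, `k*n²≤4n^k` gives n^(-k) ≤ (4/k) / n², weakened to (4/k) /
  -- (n (n - 1)); telescoping with c = 2/k then adds 4/k.
  partialSum-integer : ∀ m → s ≡ (2 ℕ.+ m) ⁄ 1 → ∀ j n → T j (suc n) ≤ 1ℚ + 4 ⁄ (2 ℕ.+ m)
  partialSum-integer m s≡k j n = ℚ.≤-trans
    (telescope (λ i → T j (suc i)) (0≤⁄ 2 k) (λ i → ℚ.+-monoʳ-≤ (T j (suc i)) (small i)) n)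
    (ℚ.≤-reflexive (cong₂ _+_ (partialSum-1 j) (trans (⁄-* 2 k 2 1) (cong-⁄ (ℕ.*-identityʳ k)))))
    where
    k = 2 ℕ.+ m
    cong-⁄ : ∀ {d} .{{_ : NonZero d}} → d ≡ k → 4 ⁄ d ≡ 4 ⁄ k
    cong-⁄ refl = refl
    small : ∀ i → q j (suc i) ≤ 2 ⁄ k * 2 ⁄ (suc i ℕ.* (2 ℕ.+ i))
    small i = ℚ.≤-trans (⁄-≤ r (suc j) 4 (k ℕ.* (suc i ℕ.* p)) (begin
        r ℕ.* (k ℕ.* (suc i ℕ.* p))    ≤⟨ ℕ.*-monoʳ-≤ r (ℕ.≤-trans (ℕ.*-monoʳ-≤ k (ℕ.*-monoˡ-≤ p (ℕ.n≤1+n (suc i)))) (k*n²≤4n^k m i)) ⟩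
        r ℕ.* (4 ℕ.* p ℕ.^ k)          ≡⟨ solve 2 (λ r x → r :* (con 4 :* x) := con 4 :* (r :* con 1 :* x)) refl r (p ℕ.^ k) ⟩
        4 ℕ.* (r ℕ.^ 1 ℕ.* p ℕ.^ k)    ≤⟨ ℕ.*-monoʳ-≤ 4 (Below-cong p ℤ.∣ ↥ s ∣ (↧ₙ s) k 1 (⁄-cross k 1 s≡k) (suc j) r (floor-lower p ℤ.∣ ↥ s ∣ (↧ₙ s) (suc j))) ⟩
        4 ℕ.* suc j ℕ.^ 1              ≡⟨ cong (4 ℕ.*_) (ℕ.*-identityʳ (suc j)) ⟩
        4 ℕ.* suc j                    ∎))
      (ℚ.≤-reflexive (sym (⁄-* 2 k 2 (suc i ℕ.* p))))
      where
      open ℕ.≤-Reasoning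
      open ℕ.+-*-Solver
      p = 2 ℕ.+ i
      r = floorPow p ℤ.∣ ↥ s ∣ (↧ₙ s) (suc j)

  -- Termwise: as (2k - 1)/k ≤ 2, the floor taken for exponent 2 also satisfies `Below` for exponent
  -- `s`, where `floorPow` is the largest such number.
  partialSum≥T₂ : ∀ m → s ≡ (2 ℕ.* (2 ℕ.+ m) ℕ.∸ 1) ⁄ (2 ℕ.+ m) → ∀ j n →
    seq (partialSum (ζ-term (2 ⁄ 1)) n) j ≤ T j n
  partialSum≥T₂ m s≡ j zero    = ℚ.≤-refl
  partialSum≥T₂ m s≡ j (suc i) = ℚ.+-mono-≤ (partialSum≥T₂ m s≡ j i)
    (⁄-≤ r M (floorPow n a b M) M (ℕ.*-monoˡ-≤ M
      (L.largest≤-bound n a b M M r (L.largest≤-bounded n 2 1 M M)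
        (Below-cong n (2 ℕ.* k ℕ.∸ 1) k a b (sym (⁄-cross (2 ℕ.* k ℕ.∸ 1) k s≡)) M r (begin
          r ℕ.^ k ℕ.* n ℕ.^ (2 ℕ.* k ℕ.∸ 1)   ≤⟨ ℕ.*-monoʳ-≤ (r ℕ.^ k) (ℕ.^-monoʳ-≤ n (ℕ.m∸n≤m (2 ℕ.* k) 1)) ⟩
          r ℕ.^ k ℕ.* n ℕ.^ (2 ℕ.* k)         ≡⟨ cong (r ℕ.^ k ℕ.*_) (sym (ℕ.^-*-assoc n 2 k)) ⟩
          r ℕ.^ k ℕ.* (n ℕ.^ 2) ℕ.^ k         ≡⟨ ^-distribʳ-* k r (n ℕ.^ 2) ⟨
          (r ℕ.* n ℕ.^ 2) ℕ.^ k               ≤⟨ ℕ.^-monoˡ-≤ k (subst₂ ℕ._≤_ (cong (ℕ._* n ℕ.^ 2) (ℕ.*-identityʳ r)) (ℕ.*-identityʳ M) (floor-lower n 2 1 M)) ⟩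
          M ℕ.^ k                             ∎)))))
    where
    open ℕ.≤-Reasoning
    k = 2 ℕ.+ m
    n = suc i
    M = suc j
    a = ℤ.∣ ↥ s ∣
    b = ↧ₙ s
    r = floorPow n 2 1 M

  -- `pow-excess` summed over the terms. The last summand collects the rounding errors, at most 2 /
  -- (j + 1) for each term.
  partialSum≤T₂+T₃⸝₂ : ∀ m → s ≡ (2 ℕ.* (2 ℕ.+ m) ℕ.∸ 1) ⁄ (2 ℕ.+ m) → ∀ j n →
    T j n ≤ seq (partialSum (ζ-term (2 ⁄ 1)) n) j
          + 2 ⁄ (2 ℕ.+ m) * seq (partialSum (ζ-term (3 ⁄ 2)) n) j
          + (2 ℕ.* n) ⁄ suc j
  partialSum≤T₂+T₃⸝₂ m s≡ j zero    = ℚ.≤-reflexive (sym (trans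
    (cong₂ _+_ (trans (ℚ.+-identityˡ _) (ℚ.*-zeroʳ (2 ⁄ (2 ℕ.+ m)))) (⁄-≡ 0 (suc j) 0 1 refl))
    (ℚ.+-identityˡ 0ℚ)))
  partialSum≤T₂+T₃⸝₂ m s≡ j (suc i) = begin
    T j i + r ⁄ M
      ≤⟨ ℚ.+-mono-≤ (partialSum≤T₂+T₃⸝₂ m s≡ j i) term ⟩
    (T₂ + 2 ⁄ k * T₃ + (2 ℕ.* i) ⁄ M) + (R ⁄ M + 2 ⁄ M + 2 ⁄ k * S ⁄ M)
      ≡⟨ solve 7 (λ a b c x y z w → (a :+ x :* b :+ c) :+ (y :+ z :+ x :* w) := (a :+ y) :+ x :* (b :+ w) :+ (c :+ z))
           refl T₂ T₃ ((2 ℕ.* i) ⁄ M) (2 ⁄ k) (R ⁄ M) (2 ⁄ M) (S ⁄ M) ⟩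
    (T₂ + R ⁄ M) + 2 ⁄ k * (T₃ + S ⁄ M) + ((2 ℕ.* i) ⁄ M + 2 ⁄ M)
      ≡⟨ cong ((T₂ + R ⁄ M) + 2 ⁄ k * (T₃ + S ⁄ M) +_) (trans (⁄-+ (2 ℕ.* i) M 2)
           (cong (_⁄ M) (trans (ℕ.+-comm (2 ℕ.* i) 2) (sym (ℕ.*-suc 2 i))))) ⟩
    (T₂ + R ⁄ M) + 2 ⁄ k * (T₃ + S ⁄ M) + (2 ℕ.* suc i) ⁄ M
      ∎
    where
    open ℚ.≤-Reasoning
    open +-*-Solver
    k = 2 ℕ.+ m
    n = suc i
    M = suc j
    a = ℤ.∣ ↥ s ∣
    b = ↧ₙ s
    r = floorPow n a b M
    R = floorPow n 2 1 M
    S = floorPow n 3 2 M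
    T₂ = seq (partialSum (ζ-term (2 ⁄ 1)) i) j
    T₃ = seq (partialSum (ζ-term (3 ⁄ 2)) i) j
    -- `pow-excess` wants n⁻² and n^(-3/2) rounded up, hence `suc R` and `suc S`. The surplus k + 2
    -- is at most 2 k, with slack m, and goes into R + 2.
    excess : k ℕ.* r ℕ.≤ k ℕ.* (R ℕ.+ 2) ℕ.+ 2 ℕ.* S
    excess = ℕ.≤-trans
      (pow-excess m M n {r} {suc R} {suc S}
        (Below-cong n a b (2 ℕ.* k ℕ.∸ 1) k (⁄-cross (2 ℕ.* k ℕ.∸ 1) k s≡) M r (floor-lower n a b M))
        (subst₂ ℕ._≤_ (ℕ.*-identityʳ M) (cong (ℕ._* n ℕ.^ 2) (ℕ.*-identityʳ (suc R))) (floor-upper n 2 1 M))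
        (floor-upper n 3 2 M))
      (ℕ.≤-trans (ℕ.m≤m+n _ m) (ℕ.≤-reflexive
        (Nat.solve 3 (λ m R S → (Nat.con 2 Nat.:+ m) Nat.:* (Nat.con 1 Nat.:+ R) Nat.:+ Nat.con 2 Nat.:* (Nat.con 1 Nat.:+ S) Nat.:+ m
          Nat.:= (Nat.con 2 Nat.:+ m) Nat.:* (R Nat.:+ Nat.con 2) Nat.:+ Nat.con 2 Nat.:* S) refl m R S)))
      where module Nat = ℕ.+-*-Solver
    term : r ⁄ M ≤ R ⁄ M + 2 ⁄ M + 2 ⁄ k * S ⁄ M
    term = begin
      r ⁄ M                                                  ≡⟨ ⁄-≡ r M (k ℕ.* r) (k ℕ.* M) (xyz r k M) ⟩
      (k ℕ.* r) ⁄ (k ℕ.* M)                                  ≤⟨ ⁄-≤ (k ℕ.* r) (k ℕ.* M) (k ℕ.* (R ℕ.+ 2) ℕ.+ 2 ℕ.* S) (k ℕ.* M) (ℕ.*-monoˡ-≤ (k ℕ.* M) excess) ⟩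
      (k ℕ.* (R ℕ.+ 2) ℕ.+ 2 ℕ.* S) ⁄ (k ℕ.* M)              ≡⟨ ⁄-+ (k ℕ.* (R ℕ.+ 2)) (k ℕ.* M) (2 ℕ.* S) ⟨
      (k ℕ.* (R ℕ.+ 2)) ⁄ (k ℕ.* M) + (2 ℕ.* S) ⁄ (k ℕ.* M)  ≡⟨ cong₂ _+_
                                                                  (trans (sym (⁄-≡ (R ℕ.+ 2) M (k ℕ.* (R ℕ.+ 2)) (k ℕ.* M) (xyz (R ℕ.+ 2) k M))) (sym (⁄-+ R M 2)))
                                                                  (sym (⁄-* 2 k S M)) ⟩
      R ⁄ M + 2 ⁄ M + 2 ⁄ k * S ⁄ M                          ∎
      where
      xyz : ∀ x k M → x ℕ.* (k ℕ.* M) ≡ k ℕ.* x ℕ.* M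
      xyz x k M = trans (sym (ℕ.*-assoc x k M)) (cong (ℕ._* M) (ℕ.*-comm x k))

1<3⁄2 : 1ℚ ℚ.< 3 ⁄ 2
1<3⁄2 = ℚ.toℚᵘ-cancel-< (ℚᵘ.*<* (ℤ.+<+ (s≤s (s≤s (s≤s z≤n)))))

-- The block tail bound with J = 0 starts right after the first term, which is 1; the exponent has
-- denominator 2, so `E 0` is 2³ = 8.
T₃⸝₂≤9 : ∀ j n → seq (partialSum (ζ-term (3 ⁄ 2)) n) j ≤ 9 ⁄ 1
T₃⸝₂≤9 j n = subst (λ x → T j n ≤ x + 8 ⁄ 1) (partialSum-1 (3 ⁄ 2) 1<3⁄2 j) (tail j 0 n 1 ℕ.≤-refl)
  where open ζ-Convergence (3 ⁄ 2) 1<3⁄2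

-- Approximants of the zeta values.

-- The index chosen locally inside `lim`, restated with the same positivity proof so that the two
-- agree by computation.
limIndex : (ℕ → ℝ) → ℕ → ℕ
limIndex x n = proj₁ (cauchy (x n) (1 ⁄ suc n) (ℚ.positive⁻¹ (1 ⁄ suc n) {{ℚ.normalize-pos 1 (suc n)}}))

-- Since `j` may be any later index, the approximants of two limits can be compared at a common one.
lim-approx : ∀ x cx n j → limIndex x n ℕ.≤ j → ∣ seq (lim x cx) n - seq (x n) j ∣ ≤ 1 ⁄ suc n
lim-approx x cx n j = proj₂ (cauchy (x n) (1 ⁄ suc n) (ℚ.positive⁻¹ (1 ⁄ suc n) {{ℚ.normalize-pos 1 (suc n)}}))
  (limIndex x n) j ℕ.≤-refl

∣-∣≤⇒≤ : ∀ a b {e} → ∣ a - b ∣ ≤ e → a ≤ b + e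
∣-∣≤⇒≤ a b {e} le = subst (_≤ b + e) (solve 2 (λ a b → b :+ (a :- b) := a) refl a b)
  (ℚ.+-monoʳ-≤ b (ℚ.≤-trans (p≤∣p∣ (a - b)) le))
  where open +-*-Solver

p≤p+q : ∀ {p q} → 0ℚ ≤ q → p ≤ p + q
p≤p+q {p} {q} 0≤q = subst (_≤ p + q) (ℚ.+-identityʳ p) (ℚ.+-monoʳ-≤ p 0≤q)

module _ (s : ℚ) (1<s : 1ℚ ℚ.< s) (1<2 : 1ℚ ℚ.< 2 ⁄ 1) (m : ℕ)
         (s≡ : s ≡ (2 ℕ.* (2 ℕ.+ m) ℕ.∸ 1) ⁄ (2 ℕ.+ m)) where

  -- The excess (2/k) · 9 contributes 18/k. Two limit approximations and the accumulated rounding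
  -- contribute 1/(n + 1) each, together at most 3/k because k ≤ n.
  ζ-near-ζ2 : ∀ n → 2 ℕ.+ m ℕ.≤ n → ∣ seq (ζ s 1<s) n - seq (ζ (2 ⁄ 1) 1<2) n ∣ ≤ 21 ⁄ (2 ℕ.+ m)
  ζ-near-ζ2 n k≤n = ∣-∣≤ Z Z₂ upper lower
    where
    open ℚ.≤-Reasoning
    open +-*-Solver
    k = 2 ℕ.+ m
    x = partialSum (ζ-term s)
    x₂ = partialSum (ζ-term (2 ⁄ 1))
    Z = seq (ζ s 1<s) n
    Z₂ = seq (ζ (2 ⁄ 1) 1<2) n
    I = limIndex x n
    I₂ = limIndex x₂ n
    -- Large enough that the accumulated rounding 2 n / (j + 1) is at most 1/(n + 1).
    J = 2 ℕ.* n ℕ.* suc n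
    j = I ℕ.⊔ (I₂ ℕ.⊔ J)
    S = seq (x n) j
    S₂ = seq (x₂ n) j
    S₃ = seq (partialSum (ζ-term (3 ⁄ 2)) n) j
    near : ∣ Z - S ∣ ≤ 1 ⁄ suc n
    near = lim-approx x (ζ-Convergence.partialSum-cauchy s 1<s) n j (ℕ.m≤m⊔n I _)
    near₂ : ∣ Z₂ - S₂ ∣ ≤ 1 ⁄ suc n
    near₂ = lim-approx x₂ (ζ-Convergence.partialSum-cauchy (2 ⁄ 1) 1<2) n j
      (ℕ.≤-trans (ℕ.m≤m⊔n I₂ J) (ℕ.m≤n⊔m I _))
    small : ∀ c → c ⁄ suc n ≤ c ⁄ k
    small c = ⁄-≤ c (suc n) c k (ℕ.*-monoʳ-≤ c (ℕ.m≤n⇒m≤1+n k≤n))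
    2n⁄j≤ : (2 ℕ.* n) ⁄ suc j ≤ 1 ⁄ suc n
    2n⁄j≤ = ⁄-≤ (2 ℕ.* n) (suc j) 1 (suc n) (ℕ.≤-trans
      (ℕ.m≤n⇒m≤1+n (ℕ.≤-trans (ℕ.m≤n⊔m I₂ J) (ℕ.m≤n⊔m I _)))
      (ℕ.≤-reflexive (sym (ℕ.*-identityˡ (suc j)))))
    upper : Z ≤ Z₂ + 21 ⁄ k
    upper = begin
      Z
        ≤⟨ ∣-∣≤⇒≤ Z S near ⟩
      S + 1 ⁄ suc n
        ≤⟨ ℚ.+-monoˡ-≤ (1 ⁄ suc n) (partialSum≤T₂+T₃⸝₂ s 1<s m s≡ j n) ⟩
      S₂ + 2 ⁄ k * S₃ + (2 ℕ.* n) ⁄ suc j + 1 ⁄ suc n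
        ≤⟨ ℚ.+-mono-≤ (ℚ.+-mono-≤ (ℚ.+-mono-≤
             (∣-∣≤⇒≤ S₂ Z₂ (subst (_≤ 1 ⁄ suc n) (∣-∣-comm Z₂ S₂) near₂))
             (ℚ.*-monoˡ-≤-nonNeg (2 ⁄ k) {{nonNegative (0≤⁄ 2 k)}} (T₃⸝₂≤9 j n))) 2n⁄j≤) ℚ.≤-refl ⟩
      Z₂ + 1 ⁄ suc n + 2 ⁄ k * 9 ⁄ 1 + 1 ⁄ suc n + 1 ⁄ suc n
        ≡⟨ solve 3 (λ z t x → z :+ t :+ x :+ t :+ t := z :+ (x :+ (t :+ t :+ t))) refl Z₂ (1 ⁄ suc n) (2 ⁄ k * 9 ⁄ 1) ⟩
      Z₂ + (2 ⁄ k * 9 ⁄ 1 + (1 ⁄ suc n + 1 ⁄ suc n + 1 ⁄ suc n))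
        ≡⟨ cong (Z₂ +_) (cong₂ _+_ (trans (⁄-* 2 k 9 1) (⁄-≡ 18 (k ℕ.* 1) 18 k (cong (18 ℕ.*_) (sym (ℕ.*-identityʳ k)))))
             (trans (cong (_+ 1 ⁄ suc n) (⁄-+ 1 (suc n) 1)) (⁄-+ 2 (suc n) 1))) ⟩
      Z₂ + (18 ⁄ k + 3 ⁄ suc n)
        ≤⟨ ℚ.+-monoʳ-≤ Z₂ (ℚ.+-monoʳ-≤ (18 ⁄ k) (small 3)) ⟩
      Z₂ + (18 ⁄ k + 3 ⁄ k)
        ≡⟨ cong (Z₂ +_) (⁄-+ 18 k 3) ⟩
      Z₂ + 21 ⁄ k
        ∎
    lower : Z₂ ≤ Z + 21 ⁄ k
    lower = begin
      Z₂                                  ≤⟨ ∣-∣≤⇒≤ Z₂ S₂ near₂ ⟩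
      S₂ + 1 ⁄ suc n                      ≤⟨ ℚ.+-monoˡ-≤ (1 ⁄ suc n) (partialSum≥T₂ s 1<s m s≡ j n) ⟩
      S + 1 ⁄ suc n                       ≤⟨ ℚ.+-monoˡ-≤ (1 ⁄ suc n) (∣-∣≤⇒≤ S Z (subst (_≤ 1 ⁄ suc n) (∣-∣-comm Z S) near)) ⟩
      Z + 1 ⁄ suc n + 1 ⁄ suc n           ≡⟨ trans (ℚ.+-assoc Z _ _) (cong (Z +_) (⁄-+ 1 (suc n) 1)) ⟩
      Z + 2 ⁄ suc n                       ≤⟨ ℚ.+-monoʳ-≤ Z (ℚ.≤-trans (small 2) (⁄-≤ 2 k 21 k (ℕ.*-monoˡ-≤ k (ℕ.m≤m+n 2 19)))) ⟩
      Z + 21 ⁄ k                          ∎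

-- Dividing the difference from `ζ-near-ζ2` by an approximant of ζ(2) does not enlarge it, as that
-- approximant is at least 1.
ζ-quotient-near-1 : ∀ s 1<s 1<2 m → s ≡ (2 ℕ.* (2 ℕ.+ m) ℕ.∸ 1) ⁄ (2 ℕ.+ m) → ∀ n → 2 ℕ.+ m ℕ.≤ n →
  ∣ seq (ζ s 1<s) n * inv (seq (ζ (2 ⁄ 1) 1<2) n) - 1ℚ ∣ ≤ 21 ⁄ (2 ℕ.+ m)
-- At index 0 the approximant of ζ(2) is the empty sum 0; k ≤ n rules this out.
ζ-quotient-near-1 s 1<s 1<2 m s≡ zero ()
ζ-quotient-near-1 s 1<s 1<2 m s≡ n@(suc n′) k≤n = begin
  ∣ Z * i - 1ℚ ∣          ≡⟨ cong (λ x → ∣ Z * i - x ∣) (sym (inv-inverseʳ 0<Z₂)) ⟩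
  ∣ Z * i - Z₂ * i ∣      ≡⟨ cong ∣_∣ (solve 3 (λ z z₂ i → z :* i :- z₂ :* i := (z :- z₂) :* i) refl Z Z₂ i) ⟩
  ∣ (Z - Z₂) * i ∣        ≡⟨ ℚ.∣p*q∣≡∣p∣*∣q∣ (Z - Z₂) i ⟩
  ∣ Z - Z₂ ∣ * ∣ i ∣      ≡⟨ cong (∣ Z - Z₂ ∣ *_) (ℚ.0≤p⇒∣p∣≡p 0≤i) ⟩
  ∣ Z - Z₂ ∣ * i          ≤⟨ *-mono-≤ (ℚ.0≤∣p∣ (Z - Z₂)) (ζ-near-ζ2 s 1<s 1<2 m s≡ n k≤n) 0≤i i≤1 ⟩
  21 ⁄ (2 ℕ.+ m) * 1ℚ     ≡⟨ ℚ.*-identityʳ _ ⟩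
  21 ⁄ (2 ℕ.+ m)          ∎
  where
  open ℚ.≤-Reasoning
  open +-*-Solver
  Z = seq (ζ s 1<s) n
  Z₂ = seq (ζ (2 ⁄ 1) 1<2) n
  i = inv Z₂
  1≤Z₂ : 1ℚ ≤ Z₂
  1≤Z₂ = ζ-Convergence.1≤partialSum (2 ⁄ 1) 1<2 n′ _
  0<Z₂ : 0ℚ ℚ.< Z₂
  0<Z₂ = ℚ.<-≤-trans (ℚ.positive⁻¹ 1ℚ) 1≤Z₂
  0≤i = 0≤inv 0<Z₂
  i≤1 : i ≤ 1ℚ
  i≤1 = subst₂ _≤_ (ℚ.*-identityˡ i) (inv-inverseʳ 0<Z₂)
    (ℚ.*-monoʳ-≤-nonNeg i {{nonNegative 0≤i}} 1≤Z₂)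

-- The partial sum bounds hold at every rounding index, in particular at the one `lim` selects, so
-- no approximation error is added.
ζ-integer-near-1 : ∀ s 1<s m → s ≡ (2 ℕ.+ m) ⁄ 1 → ∀ n → 2 ℕ.+ m ℕ.≤ n →
  ∣ seq (ζ s 1<s) n - 1ℚ ∣ ≤ 4 ⁄ (2 ℕ.+ m)
ζ-integer-near-1 s 1<s m s≡k zero ()
ζ-integer-near-1 s 1<s m s≡k (suc n) k≤n = ∣-∣≤ (seq (ζ s 1<s) (suc n)) 1ℚ
  (partialSum-integer s 1<s m s≡k _ n)
  (ℚ.≤-trans (ζ-Convergence.1≤partialSum s 1<s n _)
    (p≤p+q (0≤⁄ 4 (2 ℕ.+ m))))

-- The product over primes.

-- Partial products stay in [0, 1], so the factor at p lowers them by at most `u p`, which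
-- `k*n²≤4n^k` bounds by a telescoping term. As `telescope` controls increases, it is applied to the
-- negated products.
eulerProduct-near-1 : ∀ m (1<k : 1 < 2 ℕ.+ m) n → 2 ℕ.≤ n →
  ∣ seq (eulerProduct (2 ℕ.+ m) 1<k) n - 1ℚ ∣ ≤ 8 ⁄ (2 ℕ.+ m)
eulerProduct-near-1 m 1<k (suc zero) (s≤s ())
eulerProduct-near-1 m 1<k (suc (suc n)) _ = ∣-∣≤ w 1ℚ
  (ℚ.≤-trans (proj₂ (W-bounds (2 ℕ.+ n))) (p≤p+q (0≤⁄ 8 k)))
  (subst₂ _≤_ (solve 1 (λ w → con 1ℚ :+ w :+ :- w := con 1ℚ) refl w)
     (trans (solve 2 (λ w x → con 1ℚ :+ w :+ (:- con 1ℚ :+ x) := w :+ x) refl w (4 ⁄ k * 2 ⁄ 1))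
       (cong (w +_) (trans (⁄-* 4 k 2 1) (⁄-≡ 8 (k ℕ.* 1) 8 k (cong (8 ℕ.*_) (sym (ℕ.*-identityʳ k)))))))
     -- `W 2` computes to the empty product 1, neither 0 nor 1 being prime; adding `1ℚ + w` undoes
     -- the negation.
     (ℚ.+-monoʳ-≤ (1ℚ + w) (telescope (λ i → - W (2 ℕ.+ i)) (0≤⁄ 4 k) step n)))
  where
  open EulerProduct-Convergence (2 ℕ.+ m) 1<k
  open +-*-Solver
  k = 2 ℕ.+ m
  w = W (2 ℕ.+ n)
  v : ℕ → ℚ
  v i = 4 ⁄ k * 2 ⁄ (suc i ℕ.* (2 ℕ.+ i))
  u≤v : ∀ i pr → u (2 ℕ.+ i) pr ≤ v i
  u≤v i pr = ℚ.≤-trans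
    (⁄-≤ (2 ℕ.* p) (suc p ℕ.* p ℕ.^ k) 8 (k ℕ.* (suc i ℕ.* p)) {{euler-denominator≢0 k p pr}} (begin
      2 ℕ.* p ℕ.* (k ℕ.* (suc i ℕ.* p))     ≡⟨ Nat.solve 3 (λ p k i → Nat.con 2 Nat.:* p Nat.:* (k Nat.:* (i Nat.:* p)) Nat.:= Nat.con 2 Nat.:* i Nat.:* (k Nat.:* (p Nat.:* p))) refl p k (suc i) ⟩
      2 ℕ.* suc i ℕ.* (k ℕ.* (p ℕ.* p))     ≤⟨ ℕ.*-mono-≤ (ℕ.*-monoʳ-≤ 2 (ℕ.≤-trans (ℕ.n≤1+n (suc i)) (ℕ.n≤1+n p))) (k*n²≤4n^k m i) ⟩
      2 ℕ.* suc p ℕ.* (4 ℕ.* p ℕ.^ k)       ≡⟨ Nat.solve 2 (λ p x → Nat.con 2 Nat.:* p Nat.:* (Nat.con 4 Nat.:* x) Nat.:= Nat.con 8 Nat.:* (p Nat.:* x)) refl (suc p) (p ℕ.^ k) ⟩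
      8 ℕ.* (suc p ℕ.* p ℕ.^ k)             ∎))
    (ℚ.≤-reflexive (sym (⁄-* 4 k 2 (suc i ℕ.* p))))
    where
    open ℕ.≤-Reasoning
    module Nat = ℕ.+-*-Solver
    p = 2 ℕ.+ i
  step : ∀ i → - W (3 ℕ.+ i) ≤ - W (2 ℕ.+ i) + v i
  step i with prime? (2 ℕ.+ i)
  ... | no  _  = p≤p+q (0≤* (0≤⁄ 4 k) (0≤⁄ 2 (suc i ℕ.* (2 ℕ.+ i))))
  ... | yes pr = begin
    - (w′ * (1ℚ - u′))   ≡⟨ solve 2 (λ w u → :- (w :* (con 1ℚ :- u)) := :- w :+ w :* u) refl w′ u′ ⟩
    - w′ + w′ * u′       ≤⟨ ℚ.+-monoʳ-≤ (- w′) (*-mono-≤ (proj₁ (W-bounds (2 ℕ.+ i))) (proj₂ (W-bounds (2 ℕ.+ i))) (0≤u (2 ℕ.+ i) pr) (u≤v i pr)) ⟩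
    - w′ + 1ℚ * v i      ≡⟨ cong (- w′ +_) (ℚ.*-identityˡ (v i)) ⟩
    - w′ + v i           ∎
    where
    open ℚ.≤-Reasoning
    w′ = W (2 ℕ.+ i)
    u′ = u (2 ℕ.+ i) pr

-- The rational prefactor and products of quantities near 1.

-- The deviation is 1/(2k - 1). The upper bound, compared with (k + 1)/k by cross-multiplication,
-- has slack k - 1.
prefactor-near-1 : ∀ m → let k = 2 ℕ.+ m in ∣ (2 ℕ.* k) ⁄ (2 ℕ.* k ℕ.∸ 1) - 1ℚ ∣ ≤ 1 ⁄ k
prefactor-near-1 m = ∣-∣≤ ((2 ℕ.* k) ⁄ (2 ℕ.* k ℕ.∸ 1)) 1ℚ
  (ℚ.≤-trans (⁄-≤ (2 ℕ.* k) (2 ℕ.* k ℕ.∸ 1) (k ℕ.+ 1) k (begin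
      2 ℕ.* k ℕ.* k                          ≤⟨ ℕ.m≤m+n (2 ℕ.* k ℕ.* k) (suc m) ⟩
      2 ℕ.* k ℕ.* k ℕ.+ suc m                ≡⟨ solve 1 (λ m → con 2 :* (con 2 :+ m) :* (con 2 :+ m) :+ (con 1 :+ m)
                                                  := (con 2 :+ m :+ con 1) :* (con 1 :+ m :+ con 1 :* (con 2 :+ m))) refl m ⟩
      (k ℕ.+ 1) ℕ.* (2 ℕ.* k ℕ.∸ 1)          ∎))
    (ℚ.≤-reflexive (trans (sym (⁄-+ k k 1)) (cong (_+ 1 ⁄ k) (⁄-≡ k k 1 1 (ℕ.*-comm k 1))))))
  (ℚ.≤-trans (⁄-≤ 1 1 (2 ℕ.* k) (2 ℕ.* k ℕ.∸ 1) (ℕ.≤-trans (ℕ.≤-reflexive (ℕ.*-identityˡ (2 ℕ.* k ℕ.∸ 1)))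
      (ℕ.≤-trans (ℕ.m∸n≤m (2 ℕ.* k) 1) (ℕ.≤-reflexive (sym (ℕ.*-identityʳ (2 ℕ.* k)))))))
    (p≤p+q (0≤⁄ 1 k)))
  where
  open ℕ.≤-Reasoning
  open ℕ.+-*-Solver
  k = 2 ℕ.+ m

-- From x y - 1 = (x - 1) y + (y - 1), with |y| ≤ 1 + b because k ≥ 1. Keeping `d` separate lets
-- callers state a numeral and prove the equation by `refl`.
*-near-1 : ∀ x y a b d k .{{_ : NonZero k}} → a ℕ.* (1 ℕ.+ b) ℕ.+ b ≡ d →
  ∣ x - 1ℚ ∣ ≤ a ⁄ k → ∣ y - 1ℚ ∣ ≤ b ⁄ k → ∣ x * y - 1ℚ ∣ ≤ d ⁄ k
*-near-1 x y a b d k refl hx hy = begin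
  ∣ x * y - 1ℚ ∣                         ≡⟨ cong ∣_∣ (solve 2 (λ x y → x :* y :- con 1ℚ := (x :- con 1ℚ) :* y :+ (y :- con 1ℚ)) refl x y) ⟩
  ∣ (x - 1ℚ) * y + (y - 1ℚ) ∣            ≤⟨ ℚ.∣p+q∣≤∣p∣+∣q∣ ((x - 1ℚ) * y) (y - 1ℚ) ⟩
  ∣ (x - 1ℚ) * y ∣ + ∣ y - 1ℚ ∣          ≡⟨ cong (_+ ∣ y - 1ℚ ∣) (ℚ.∣p*q∣≡∣p∣*∣q∣ (x - 1ℚ) y) ⟩
  ∣ x - 1ℚ ∣ * ∣ y ∣ + ∣ y - 1ℚ ∣        ≤⟨ ℚ.+-mono-≤ (*-mono-≤ (ℚ.0≤∣p∣ (x - 1ℚ)) hx (ℚ.0≤∣p∣ y) ∣y∣≤) hy ⟩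
  a ⁄ k * (1 ℕ.+ b) ⁄ 1 + b ⁄ k          ≡⟨ cong (_+ b ⁄ k) (trans (⁄-* a k (1 ℕ.+ b) 1)
                                              (⁄-≡ (a ℕ.* (1 ℕ.+ b)) (k ℕ.* 1) (a ℕ.* (1 ℕ.+ b)) k (cong (a ℕ.* (1 ℕ.+ b) ℕ.*_) (sym (ℕ.*-identityʳ k))))) ⟩
  (a ℕ.* (1 ℕ.+ b)) ⁄ k + b ⁄ k          ≡⟨ ⁄-+ (a ℕ.* (1 ℕ.+ b)) k b ⟩
  (a ℕ.* (1 ℕ.+ b) ℕ.+ b) ⁄ k            ∎
  where
  open ℚ.≤-Reasoning
  open +-*-Solver
  instance
    k*1≢0 : NonZero (k ℕ.* 1)
    k*1≢0 = ℕ.m*n≢0 k 1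
  ∣y∣≤ : ∣ y ∣ ≤ (1 ℕ.+ b) ⁄ 1
  ∣y∣≤ = begin
    ∣ y ∣                  ≡⟨ cong ∣_∣ (solve 1 (λ y → y := con 1ℚ :+ (y :- con 1ℚ)) refl y) ⟩
    ∣ 1ℚ + (y - 1ℚ) ∣      ≤⟨ ℚ.∣p+q∣≤∣p∣+∣q∣ 1ℚ (y - 1ℚ) ⟩
    1ℚ + ∣ y - 1ℚ ∣        ≤⟨ ℚ.+-monoʳ-≤ 1ℚ (ℚ.≤-trans hy (⁄-≤ b k b 1 (ℕ.*-monoʳ-≤ b (ℕ.>-nonZero⁻¹ k)))) ⟩
    1 ⁄ 1 + b ⁄ 1          ≡⟨ ⁄-+ 1 1 b ⟩
    (1 ℕ.+ b) ⁄ 1          ∎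

-- Assembling the constants `c k`.

2-1/k≡ : ∀ m (1<k : 1 < 2 ℕ.+ m) →
  2 ⁄ 1 - recipℕ (2 ℕ.+ m) 1<k ≡ (2 ℕ.* (2 ℕ.+ m) ℕ.∸ 1) ⁄ (2 ℕ.+ m)
2-1/k≡ m 1<k = begin
  2 ⁄ 1 - 1 ⁄ k                               ≡⟨ cong (_- 1 ⁄ k) (⁄-≡ 2 1 (2 ℕ.* k ℕ.∸ 1 ℕ.+ 1) k
                                                   (trans (sym (ℕ.m∸n+n≡m {2 ℕ.* k} (s≤s z≤n))) (sym (ℕ.*-identityʳ (2 ℕ.* k ℕ.∸ 1 ℕ.+ 1))))) ⟩
  (2 ℕ.* k ℕ.∸ 1 ℕ.+ 1) ⁄ k - 1 ⁄ k           ≡⟨ cong (_- 1 ⁄ k) (⁄-+ (2 ℕ.* k ℕ.∸ 1) k 1) ⟨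
  (2 ℕ.* k ℕ.∸ 1) ⁄ k + 1 ⁄ k - 1 ⁄ k         ≡⟨ solve 2 (λ x t → x :+ t :- t := x) refl ((2 ℕ.* k ℕ.∸ 1) ⁄ k) (1 ⁄ k) ⟩
  (2 ℕ.* k ℕ.∸ 1) ⁄ k                         ∎
  where
  open ≡-Reasoning
  open +-*-Solver
  k = 2 ℕ.+ m

-- Iterating d = a (1 + b) + b: 1 and 21 give 43, 4 and 4 give 24, 43 and 24 give 1099, and 1099 and
-- 8 give 9899.
product-near-1 : ∀ x a b y w k .{{_ : NonZero k}} → x ≡ a * b * (y * y) * w →
  ∣ a - 1ℚ ∣ ≤ 1 ⁄ k → ∣ b - 1ℚ ∣ ≤ 21 ⁄ k → ∣ y - 1ℚ ∣ ≤ 4 ⁄ k → ∣ w - 1ℚ ∣ ≤ 8 ⁄ k →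
  ∣ x - 1ℚ ∣ ≤ 9899 ⁄ k
product-near-1 x a b y w k refl ha hb hy hw =
  *-near-1 (a * b * (y * y)) w 1099 8 9899 k refl
    (*-near-1 (a * b) (y * y) 43 24 1099 k refl
      (*-near-1 a b 1 21 43 k refl ha hb) (*-near-1 y y 4 4 24 k refl hy hy)) hw

-- Spelling k as 2 ℕ.+ m instead of suc (suc m) makes the check of refl diverge.
c-near-1 : ∀ m (1<k : 1 < suc (suc m)) n → suc (suc m) ℕ.≤ n →
  ∣ seq (c (suc (suc m)) 1<k) n - 1ℚ ∣ ≤ 9899 ⁄ suc (suc m)
c-near-1 m 1<k n k≤n = product-near-1 (seq (c (suc (suc m)) 1<k) n)
  ((2 ℕ.* suc (suc m)) ⁄ (2 ℕ.* suc (suc m) ℕ.∸ 1))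
  (seq (ζ (2 ⁄ 1 - recipℕ (suc (suc m)) 1<k) (1<2-1/k (suc (suc m)) 1<k)) n * inv (seq (ζ (2 ⁄ 1) (1<k⁄1 ℕ.≤-refl)) n))
  (seq (ζ (suc (suc m) ⁄ 1) (1<k⁄1 1<k)) n)
  (seq (eulerProduct (suc (suc m)) 1<k) n)
  (suc (suc m))
  refl
  (prefactor-near-1 m)
  (ζ-quotient-near-1 (2 ⁄ 1 - recipℕ (suc (suc m)) 1<k) (1<2-1/k (suc (suc m)) 1<k) (1<k⁄1 ℕ.≤-refl) m (2-1/k≡ m 1<k) n k≤n)
  (ζ-integer-near-1 (suc (suc m) ⁄ 1) (1<k⁄1 1<k) m refl n k≤n)
  (eulerProduct-near-1 m 1<k n (ℕ.≤-trans (s≤s (s≤s z≤n)) k≤n))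

⁄-split : ∀ a k .{{_ : NonZero k}} → a ⁄ k ≡ a ⁄ 1 * 1 ⁄ k
⁄-split a k = sym (trans (⁄-* a 1 1 k) (⁄-≡ (a ℕ.* 1) (1 ℕ.* k) a k
  (cong₂ ℕ._*_ (ℕ.*-identityʳ a) (sym (ℕ.*-identityˡ k)))))
  where
  instance
    1*k≢0 : NonZero (1 ℕ.* k)
    1*k≢0 = ℕ.m*n≢0 1 k

-- The approximants obey the bound without error from index k on, so k serves as threshold for every
-- ε.
eventually-near⇒≤ᴿ : ∀ x q a k .{{_ : NonZero k}} → (∀ n → k ℕ.≤ n → ∣ seq x n - q ∣ ≤ a ⁄ k) →
  ∣ x -ᴿ fromℚ q ∣ᴿ ≤ᴿ fromℚ (a ⁄ 1) *ᴿ fromℚ (1 ⁄ k)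
eventually-near⇒≤ᴿ x q a k near ε 0<ε = k , λ n k≤n → ℚ.≤-trans (near n k≤n)
  (ℚ.≤-trans (ℚ.≤-reflexive (⁄-split a k)) (p≤p+q (ℚ.<⇒≤ 0<ε)))

theorem3p1 : Σ[ C ∈ ℝ ] ((k : ℕ) (1<k : 1 < k) →
    ∣ c k 1<k -ᴿ fromℚ 1ℚ ∣ᴿ ≤ᴿ C *ᴿ fromℚ (recipℕ k 1<k))
theorem3p1 = fromℚ (9899 ⁄ 1) , bound
  where
  bound : (k : ℕ) (1<k : 1 < k) →
    ∣ c k 1<k -ᴿ fromℚ 1ℚ ∣ᴿ ≤ᴿ fromℚ (9899 ⁄ 1) *ᴿ fromℚ (recipℕ k 1<k)
  bound (suc zero) (s≤s ())
  bound (suc (suc m)) 1<k = eventually-near⇒≤ᴿ (c (suc (suc m)) 1<k) 1ℚ 9899 (suc (suc m)) (c-near-1 m 1<k)
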